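{- For fixed integers $d\geq 4$ and $p\geq 3$, $$\mathbf{RT}_{d}(n,K_{2p-1},o(n)) = \mathbf{RT}_{d}(n,K_{2p},o(n)) = \frac{1}{2}\left(1-\frac{1}{p-1}\right)n^2+o(n^2).$$
   Context: For a graph $G=(V,E)$ and $v\in V$, $N(v)$ is the set of neighbors of $v$; the VC-dimension of $G$ is the largest $d$ such that some $d$-element $S\subset V$ satisfies: for every $B\subset S$ there is $v\in V$ with $N(v)\cap S=B$. $\mathbf{RT}_d(n,K_q,o(n))$ denotes the maximum number of edges of an $n$-vertex $K_q$-free graph of VC-dimension at most $d$ whose independence number is $o(n)$. Precisely, writing $\mathbf{RT}_d(n,K_q,m)$ for the maximum number of edges of an $n$-vertex $K_q$-free graph of VC-dimension at most $d$ with independence number at most $m$, the statement $\mathbf{RT}_d(n,K_q,o(n))=\frac12(1-\frac1{p-1})n^2+o(n^2)$ means $\lim_{\gamma\to 0^+}\limsup_{n\to\infty}\mathbf{RT}_d(n,K_q,\gamma n)/n^2=\lim_{\gamma\to 0^+}\liminf_{n\to\infty}\mathbf{RT}_d(n,K_q,\gamma n)/n^2=\frac12(1-\frac1{p-1})$. -}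

module Defs where

open import Data.Nat using (ℕ; zero; suc; _+_; _≤_; _<ᵇ_)
open import Data.Bool using (Bool; true; false; if_then_else_; _∧_)
open import Data.Fin using (Fin; toℕ)
open import Data.Vec using (Vec; lookup)
open import Data.Integer using (+_)
open import Data.Product using (∃; _×_)
open import Function.Definitions using (Injective)
open import Relation.Binary.PropositionalEquality using (_≡_; _≢_)
open import Relation.Nullary using (¬_)
open import Data.Rational using (ℚ; _/_; _-_; _*_; ½; 1ℚ; 0ℚ)

record Graph (n : ℕ) : Set where
  field
    adj   : Fin n → Fin n → Bool
    sym   : ∀ i j → adj i j ≡ adj j i
    irrefl : ∀ i → adj i i ≡ false
open Graph public

sumFin : (n : ℕ) → (Fin n → ℕ) → ℕ
sumFin zero f = 0
sumFin (suc n) f = f Fin.zero + sumFin n (λ i → f (Fin.suc i))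


edgeCount : ∀ {n} → Graph n → ℕ
edgeCount {n} G =
  sumFin n (λ i → sumFin n (λ j →
    if adj G i j ∧ (toℕ i <ᵇ toℕ j) then 1 else 0))

HasClique : ∀ {n} → ℕ → Graph n → Set
HasClique {n} q G = ∃ λ (f : Fin q → Fin n) →
  Injective _≡_ _≡_ f × (∀ i j → i ≢ j → adj G (f i) (f j) ≡ true)

KFree : ∀ {n} → ℕ → Graph n → Set
KFree q G = ¬ HasClique q G

HasIndependentSet : ∀ {n} → ℕ → Graph n → Set
HasIndependentSet {n} k G = ∃ λ (f : Fin k → Fin n) →
  Injective _≡_ _≡_ f × (∀ i j → adj G (f i) (f j) ≡ false)

-- S (an injective image of Fin k) is shattered: for every B ⊆ S (given by its
-- characteristic vector) some vertex v has N(v) ∩ S = B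
Shattered : ∀ {n} → Graph n → (k : ℕ) → (Fin k → Fin n) → Set
Shattered {n} G k f = ∀ (B : Vec Bool k) → ∃ λ (v : Fin n) →
  ∀ i → adj G v (f i) ≡ lookup B i

VCdim≤ : ∀ {n} → ℕ → Graph n → Set
VCdim≤ {n} d G = ∀ k (f : Fin k → Fin n) → Injective _≡_ _≡_ f →
  Shattered G k f → k ≤ d

ℕ→ℚ : ℕ → ℚ
ℕ→ℚ m = (+ m) / 1

-- the constant (1/2)(1 - 1/(p-1)); only meaningful for p ≥ 2
rtConst : ℕ → ℚ
rtConst (suc (suc k)) = ½ * (1ℚ - ((+ 1) / suc k))
rtConst _ = 0ℚ

{-# OPTIONS --safe #-}

-- Upper bound.  Let T be the largest degree threshold exceeded by linearly many
-- vertices.  Bounded VC-dimension forbids many pairwise dissimilar neighbourhoods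
-- (a few vertices chosen greedily would separate all of them, against Sauer–Shelah),
-- so linearly many of these vertices have nearly the same neighbourhood, and the
-- bound on the independence number yields an edge uv among them.  The common
-- neighbourhood of u and v has about T vertices and a clique number smaller by two,
-- so Erdős' degree majorization proves the Turán-type bound by induction.
--
-- Lower bound.  Burling's construction produces triangle-free graphs of unbounded
-- fractional chromatic number.  The join of p - 1 blow-ups of such a graph has no
-- K_{2p-1} and a small independence number.  A set of four vertices shattered by it
-- would have all its proper nonempty subsets cut out by neighbourhoods and probes of
-- one Burling graph, which the laminar structure of the probes excludes.

module Submission where

open import Defs renaming (sym to adj-sym)
open import Data.Bool using (Bool; true; false; if_then_else_; _∧_; _∨_; not)
import Data.Bool.Properties as Bool
open import Data.Fin using (Fin; zero; suc; toℕ; combine; remQuot; splitAt; inject≤; punchIn; _↑ˡ_; _↑ʳ_)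
import Data.Fin.Properties as Fin
open import Data.Product using (Σ; ∃; _×_; _,_; proj₁; proj₂)
open import Data.Sum using (_⊎_; inj₁; inj₂)
open import Data.Empty using (⊥; ⊥-elim)
open import Relation.Nullary using (¬_; Dec; yes; no; contradiction; ¬?)
open import Relation.Nullary.Decidable using (⌊_⌋; decidable-stable; map′; toWitness; _×-dec_)
open import Relation.Binary.PropositionalEquality
  using (_≡_; _≢_; refl; sym; trans; cong; cong₂; subst; subst₂; module ≡-Reasoning)
open import Function using (_∘_; id)
open import Function.Definitions using (Injective)

-- The bounds meet because both sides trade two clique vertices for one Turán class: an edge with
-- similar ends costs two vertices of a clique, and a triangle-free part of the join admits at most
-- two. This gives `p - 1` classes for `2p - 1` and for `2p` alike. Similarity of the ends is
-- essential: a degree above `T` yields `T` neighbours of each end, but the majorization needs about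
-- `T` common ones. In the lower bound the base graph is fixed while `n` grows, so a blow-up has few
-- independent vertices only if all weighted independent sets of the base graph are light. Large
-- chromatic number would not suffice; hence the fractional version, with multiplicities as weights.
-- Vertices of the other parts realise the full trace on a set inside one part, so the base graph
-- has to fail already on proper nonempty subsets. Denominators are cleared until the end: `g`
-- stands for `1 / γ` in `k * g ≤ n`, and a multiplier `e` against an error `n * n` stands for
-- `1 / ε`.

module Combinatorics where

  open import Data.Nat using (ℕ; zero; suc; _+_; _*_; _^_; _≤_; _<_; z≤n; s≤s; _≤?_; _<?_; _/_; _%_; NonZero; >-nonZero)
  open import Data.Nat.DivMod using (_mod_; m≡m%n+[m/n]*n; m%n<n; m<n⇒m%n≡m; [m+n]%n≡m%n)
  open import Data.Nat.Properties
  open import Data.Nat.Tactic.RingSolver using (solve-∀)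
  open import Data.List using (List; []; _∷_; _++_; concatMap; length) renaming (lookup to lookupL)
  import Data.List as List
  open import Data.Unit using (⊤; tt)
  open import Data.Vec using (Vec; []; _∷_; lookup; map; tabulate; replicate) renaming (_++_ to _++ᵛ_)
  import Data.Vec.Properties as Vec
  open import Data.Vec.Functional using (insertAt)
  import Data.Vec.Functional.Properties as Functional

  -- Finite sums and counting.

  ⟦_⟧ : Bool → ℕ
  ⟦ b ⟧ = if b then 1 else 0

  count : ∀ {n} → (Fin n → Bool) → ℕ
  count {n} B = sumFin n (λ i → ⟦ B i ⟧)

  sum-cong : ∀ n {f g : Fin n → ℕ} → (∀ i → f i ≡ g i) → sumFin n f ≡ sumFin n g
  sum-cong zero    eq = refl
  sum-cong (suc n) eq = cong₂ _+_ (eq zero) (sum-cong n (eq ∘ suc))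

  sum-mono : ∀ n {f g : Fin n → ℕ} → (∀ i → f i ≤ g i) → sumFin n f ≤ sumFin n g
  sum-mono zero    le = z≤n
  sum-mono (suc n) le = +-mono-≤ (le zero) (sum-mono n (le ∘ suc))

  sum-+ : ∀ n (f g : Fin n → ℕ) → sumFin n (λ i → f i + g i) ≡ sumFin n f + sumFin n g
  sum-+ zero    f g = refl
  sum-+ (suc n) f g = trans (cong (f zero + g zero +_) (sum-+ n (f ∘ suc) (g ∘ suc)))
                            (+-interchange (f zero) (g zero) _ _)
    where
    +-interchange : ∀ a b c d → a + b + (c + d) ≡ a + c + (b + d)
    +-interchange = solve-∀

  sum-*ˡ : ∀ n c (f : Fin n → ℕ) → sumFin n (λ i → c * f i) ≡ c * sumFin n f
  sum-*ˡ zero    c f = sym (*-zeroʳ c)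
  sum-*ˡ (suc n) c f = trans (cong (c * f zero +_) (sum-*ˡ n c (f ∘ suc)))
                             (sym (*-distribˡ-+ c (f zero) _))

  sum-const : ∀ n c → sumFin n (λ _ → c) ≡ n * c
  sum-const zero    c = refl
  sum-const (suc n) c = cong (c +_) (sum-const n c)

  sum-swap : ∀ m n (f : Fin m → Fin n → ℕ) →
    sumFin m (λ i → sumFin n (f i)) ≡ sumFin n (λ j → sumFin m (λ i → f i j))
  sum-swap zero    n f = sym (trans (sum-const n 0) (*-zeroʳ n))
  sum-swap (suc m) n f = trans (cong (sumFin n (f zero) +_) (sum-swap m n (f ∘ suc)))
                               (sym (sum-+ n (f zero) _))

  sum>0⇒∃ : ∀ n (f : Fin n → ℕ) → 0 < sumFin n f → ∃ λ i → 0 < f i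
  sum>0⇒∃ (suc n) f lt with f zero in eq
  ... | suc k = zero , subst (0 <_) (sym eq) (s≤s z≤n)
  ... | zero  with i , p ← sum>0⇒∃ n (f ∘ suc) lt = suc i , p

  term≤sum : ∀ n (f : Fin n → ℕ) i → f i ≤ sumFin n f
  term≤sum (suc n) f zero    = m≤m+n _ _
  term≤sum (suc n) f (suc i) = ≤-trans (term≤sum n (f ∘ suc) i) (m≤n+m _ _)

  -- If every term stayed below `c`, the sum would fall short of `n * c` by at least `n`, which
  -- `0 < n` forbids; `split` records that shortfall.
  sum-average : ∀ n c (f : Fin n → ℕ) → 0 < n → n * c ≤ sumFin n f → ∃ λ i → c ≤ f i
  sum-average n c f n>0 le with split n f
    where
    +-interchange : ∀ a b m → a + b + suc m ≡ suc a + (b + m)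
    +-interchange = solve-∀
    split : ∀ n (f : Fin n → ℕ) → (∃ λ i → c ≤ f i) ⊎ (sumFin n f + n ≤ n * c)
    split zero    f = inj₂ z≤n
    split (suc n) f with c ≤? f zero | split n (f ∘ suc)
    ... | yes p | _            = inj₁ (zero , p)
    ... | no ¬p | inj₁ (i , p) = inj₁ (suc i , p)
    ... | no ¬p | inj₂ q       = inj₂ (≤-trans (≤-reflexive (+-interchange (f zero) _ n)) (+-mono-≤ (≰⇒> ¬p) q))
  ... | inj₁ p = p
  ... | inj₂ q = contradiction n>0 (≤⇒≯ (+-cancelˡ-≤ (sumFin n f) _ _ (≤-trans q (≤-trans le (≤-reflexive (sym (+-identityʳ _)))))))

  sum-++ : ∀ m n (f : Fin (m + n) → ℕ) →
    sumFin (m + n) f ≡ sumFin m (λ i → f (i ↑ˡ n)) + sumFin n (λ j → f (m ↑ʳ j))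
  sum-++ zero    n f = refl
  sum-++ (suc m) n f = trans (cong (f zero +_) (sum-++ m n (f ∘ suc))) (sym (+-assoc (f zero) _ _))

  ⟦⟧≤1 : ∀ b → ⟦ b ⟧ ≤ 1
  ⟦⟧≤1 true  = s≤s z≤n
  ⟦⟧≤1 false = z≤n

  ⟦⟧>0 : ∀ {b} → 0 < ⟦ b ⟧ → b ≡ true
  ⟦⟧>0 {true} _ = refl

  ∧-true : ∀ {a b} → a ∧ b ≡ true → a ≡ true × b ≡ true
  ∧-true {true} {true} _ = refl , refl

  ¬true⇒false : ∀ {b} → b ≢ true → b ≡ false
  ¬true⇒false {true}  p = ⊥-elim (p refl)
  ¬true⇒false {false} p = refl

  ⌊⌋-true : ∀ {P : Set} (d : Dec P) → P → ⌊ d ⌋ ≡ true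
  ⌊⌋-true (yes _) _ = refl
  ⌊⌋-true (no ¬p) p = ⊥-elim (¬p p)

  ⌊⌋-sound : ∀ {P : Set} (d : Dec P) → ⌊ d ⌋ ≡ true → P
  ⌊⌋-sound (yes p) _ = p

  ⌊⌋-false : ∀ {P : Set} (d : Dec P) → ¬ P → ⌊ d ⌋ ≡ false
  ⌊⌋-false (yes p) ¬p = ⊥-elim (¬p p)
  ⌊⌋-false (no _)  _  = refl

  count>0⇒∃ : ∀ {n} (B : Fin n → Bool) → 0 < count B → ∃ λ i → B i ≡ true
  count>0⇒∃ {n} B lt with i , p ← sum>0⇒∃ n _ lt = i , ⟦⟧>0 p

  count≤ : ∀ {n} (B : Fin n → Bool) → count B ≤ n
  count≤ {n} B = ≤-trans (sum-mono n (λ i → ⟦⟧≤1 (B i))) (≤-reflexive (trans (sum-const n 1) (*-identityʳ n)))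

  enum : ∀ {n} (B : Fin n → Bool) →
    Σ (Fin (count B) → Fin n) λ f → Injective _≡_ _≡_ f × (∀ i → B (f i) ≡ true)
  enum {zero}  B = (λ ()) , (λ { {()} }) , λ ()
  enum {suc n} B with B zero in eq | enum (B ∘ suc)
  ... | false | f , inj , ok = suc ∘ f , inj ∘ Fin.suc-injective , ok
  ... | true  | f , inj , ok = g , g-inj , g-ok
    where
    g : Fin (suc (count (B ∘ suc))) → Fin (suc n)
    g zero    = zero
    g (suc i) = suc (f i)
    g-inj : Injective _≡_ _≡_ g
    g-inj {zero}  {zero}  _ = refl
    g-inj {suc i} {suc j} e = cong suc (inj (Fin.suc-injective e))
    g-ok : ∀ i → B (g i) ≡ true
    g-ok zero    = eq
    g-ok (suc i) = ok i

  first : ∀ b m → b ≡ true → Fin (⟦ b ⟧ + m)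
  first true m _ = zero

  first≢shift : ∀ b m p (j : Fin m) → first b m p ≢ ⟦ b ⟧ ↑ʳ j
  first≢shift true m p j ()

  -- `count B` unfolds to a sum starting with `⟦ B zero ⟧`, so a shift by that summand gives the
  -- position without a case split on `B zero`.
  index : ∀ {n} (B : Fin n → Bool) x → B x ≡ true → Fin (count B)
  index B zero    Bx = first (B zero) _ Bx
  index B (suc x) Bx = ⟦ B zero ⟧ ↑ʳ index (B ∘ suc) x Bx

  index-injective : ∀ {n} (B : Fin n → Bool) x y Bx By → index B x Bx ≡ index B y By → x ≡ y
  index-injective B zero    zero    Bx By e = refl
  index-injective B zero    (suc y) Bx By e = contradiction e (first≢shift (B zero) _ Bx _)
  index-injective B (suc x) zero    Bx By e = contradiction (sym e) (first≢shift (B zero) _ By _)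
  index-injective B (suc x) (suc y) Bx By e =
    cong suc (index-injective (B ∘ suc) x y Bx By (Fin.↑ʳ-injective ⟦ B zero ⟧ _ _ e))

  injective⇒≤count : ∀ {n k} (B : Fin n → Bool) (f : Fin k → Fin n) → Injective _≡_ _≡_ f →
    (∀ i → B (f i) ≡ true) → k ≤ count B
  injective⇒≤count B f inj ok =
    Fin.injective⇒≤ {f = λ i → index B (f i) (ok i)} λ e → inj (index-injective B _ _ _ _ e)

  -- The Sauer–Shelah lemma

  countV : ∀ t → (Vec Bool t → Bool) → ℕ
  countV zero    P = ⟦ P [] ⟧
  countV (suc t) P = countV t (P ∘ (true ∷_)) + countV t (P ∘ (false ∷_))

  indexV : ∀ {t} (P : Vec Bool t → Bool) c → P c ≡ true → Fin (countV t P)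
  indexV P []          Pc = first′ (P []) Pc
    where
    first′ : ∀ b → b ≡ true → Fin ⟦ b ⟧
    first′ true _ = zero
  indexV P (true  ∷ c) Pc = indexV (P ∘ (true ∷_)) c Pc ↑ˡ _
  indexV P (false ∷ c) Pc = countV _ (P ∘ (true ∷_)) ↑ʳ indexV (P ∘ (false ∷_)) c Pc

  ↑ˡ≢↑ʳ : ∀ {m n} (i : Fin m) (j : Fin n) → i ↑ˡ n ≢ m ↑ʳ j
  ↑ˡ≢↑ʳ {m} {n} i j e = contradiction (trans (sym (Fin.splitAt-↑ˡ m i n)) (trans (cong (splitAt m) e) (Fin.splitAt-↑ʳ m n j))) λ ()

  indexV-injective : ∀ {t} (P : Vec Bool t → Bool) c d Pc Pd → indexV P c Pc ≡ indexV P d Pd → c ≡ d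
  indexV-injective P []          []          Pc Pd e = refl
  indexV-injective P (true  ∷ c) (true  ∷ d) Pc Pd e =
    cong (true ∷_) (indexV-injective _ c d Pc Pd (Fin.↑ˡ-injective _ _ _ e))
  indexV-injective P (true  ∷ c) (false ∷ d) Pc Pd e = contradiction e (↑ˡ≢↑ʳ _ _)
  indexV-injective P (false ∷ c) (true  ∷ d) Pc Pd e = contradiction (sym e) (↑ˡ≢↑ʳ _ _)
  indexV-injective P (false ∷ c) (false ∷ d) Pc Pd e =
    cong (false ∷_) (indexV-injective _ c d Pc Pd (Fin.↑ʳ-injective _ _ _ e))

  -- Applied to the two halves of a family at its first coordinate, this splits its size into the
  -- projection (`∨`) and the vectors that extend both ways (`∧`), the two branches of the
  -- Sauer-Shelah induction.
  countV-∨∧ : ∀ t (P Q : Vec Bool t → Bool) →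
    countV t P + countV t Q ≡ countV t (λ c → P c ∨ Q c) + countV t (λ c → P c ∧ Q c)
  countV-∨∧ zero P Q with P [] | Q []
  ... | true  | true  = refl
  ... | true  | false = refl
  ... | false | true  = refl
  ... | false | false = refl
  countV-∨∧ (suc t) P Q =
    trans (interchange (countV t (P ∘ (true ∷_))) _ _ _)
    (trans (cong₂ _+_ (countV-∨∧ t (P ∘ (true ∷_)) (Q ∘ (true ∷_))) (countV-∨∧ t (P ∘ (false ∷_)) (Q ∘ (false ∷_))))
    (interchange (countV t (λ c → P (true ∷ c) ∨ Q (true ∷ c))) _ _ _))
    where
    interchange : ∀ a b c d → a + b + (c + d) ≡ a + c + (b + d)
    interchange = solve-∀

  countV>0⇒∃ : ∀ t (P : Vec Bool t → Bool) → 0 < countV t P → ∃ λ c → P c ≡ true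
  countV>0⇒∃ zero P lt = [] , ⟦⟧>0 lt
  countV>0⇒∃ (suc t) P lt with countV t (P ∘ (true ∷_)) in eq
  ... | suc k with c , p ← countV>0⇒∃ t (P ∘ (true ∷_)) (subst (0 <_) (sym eq) (s≤s z≤n)) = true ∷ c , p
  ... | zero  with c , p ← countV>0⇒∃ t (P ∘ (false ∷_)) lt = false ∷ c , p

  -- sauer t k = Σ_{i<k} C(t,i)
  sauer : ℕ → ℕ → ℕ
  sauer t       zero    = 0
  sauer zero    (suc k) = 1
  sauer (suc t) (suc k) = sauer t (suc k) + sauer t k

  ShattersV : ∀ {t} → (Vec Bool t → Bool) → (k : ℕ) → (Fin k → Fin t) → Set
  ShattersV P k g = ∀ (B : Vec Bool k) → ∃ λ c → P c ≡ true × (∀ i → lookup c (g i) ≡ lookup B i)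

  +-<-split : ∀ a b x y → a + b < x + y → a < x ⊎ b < y
  +-<-split a b x y lt with a <? x
  ... | yes a<x = inj₁ a<x
  ... | no  a≮x = inj₂ (≰⇒> λ y≤b → contradiction lt (≤⇒≯ (+-mono-≤ (≮⇒≥ a≮x) y≤b)))

  -- Pascal's rule in `sauer` matches that split. Either the projection is too large and shatters
  -- `suc k` later coordinates, or too many vectors extend both ways and the first coordinate joins
  -- the `k` coordinates that they shatter.
  sauer-shelah : ∀ t k (P : Vec Bool t → Bool) → sauer t k < countV t P → ∃ (ShattersV P k)
  sauer-shelah t zero P lt with c , p ← countV>0⇒∃ t P lt = (λ ()) , λ { [] → c , p , λ () }
  sauer-shelah zero (suc k) P lt = contradiction lt (≤⇒≯ (⟦⟧≤1 (P [])))
  sauer-shelah (suc t) (suc k) P lt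
    with +-<-split (sauer t (suc k)) _ _ _ (<-≤-trans lt (≤-reflexive (countV-∨∧ t (P ∘ (true ∷_)) (P ∘ (false ∷_)))))
  ... | inj₁ lt∨ with g , sh ← sauer-shelah t (suc k) _ lt∨ = suc ∘ g , sh′
    where
    sh′ : ShattersV P (suc k) (suc ∘ g)
    sh′ B with c , p , eq ← sh B with P (true ∷ c) in e
    ... | true  = true ∷ c , e , eq
    ... | false = false ∷ c , p , eq
  ... | inj₂ lt∧ with g , sh ← sauer-shelah t k (λ c → P (true ∷ c) ∧ P (false ∷ c)) lt∧ = g′ , sh′
    where
    g′ : Fin (suc k) → Fin (suc t)
    g′ zero    = zero
    g′ (suc i) = suc (g i)
    sh′ : ShattersV P (suc k) g′
    sh′ (b ∷ B) with c , p , eq ← sh B = b ∷ c , pick b (∧-true p) , λ { zero → refl ; (suc i) → eq i }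
      where
      pick : ∀ b → P (true ∷ c) ≡ true × P (false ∷ c) ≡ true → P (b ∷ c) ≡ true
      pick true  = proj₁
      pick false = proj₂

  sauer≤ : ∀ t d → sauer t (suc d) ≤ suc t ^ d
  sauer≤ zero    d       = m^n>0 1 d
  sauer≤ (suc t) zero    = ≤-trans (≤-reflexive (+-identityʳ _)) (sauer≤ t zero)
  sauer≤ (suc t) (suc d) = begin
    sauer t (suc (suc d)) + sauer t (suc d)  ≤⟨ +-mono-≤ (sauer≤ t (suc d)) (sauer≤ t d) ⟩
    suc t * suc t ^ d + suc t ^ d            ≡⟨ +-comm (suc t * suc t ^ d) _ ⟩
    suc (suc t) * suc t ^ d                  ≤⟨ *-monoʳ-≤ (suc (suc t)) (^-monoˡ-≤ d (n≤1+n (suc t))) ⟩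
    suc (suc t) * suc (suc t) ^ d            ∎
    where open ≤-Reasoning

  -- Packing of neighbourhoods

  differ : Bool → Bool → Bool
  differ a b = ⌊ ¬? (a Bool.≟ b) ⌋

  -- The size of the symmetric difference of two neighbourhoods, a pseudometric on the vertices.
  diff : ∀ {n} → Graph n → Fin n → Fin n → ℕ
  diff G u v = count (λ x → differ (adj G u x) (adj G v x))

  count₂ : ∀ {K} → (Fin K → Fin K → Bool) → ℕ
  count₂ {K} R = sumFin K (λ i → count (R i))

  trace : ∀ {n t} → Graph n → Vec (Fin n) t → Fin n → Vec Bool t
  trace G xs v = map (adj G v) xs

  Far : ∀ {n K} → Graph n → ℕ → (Fin K → Fin n) → (Fin K → Fin K → Bool) → Set
  Far {n} G E u R = ∀ i j → R i j ≡ true → n ≤ suc E * diff G (u i) (u j)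

  -- Averaging over x: some x separates a 1/(E+1) fraction of the far pairs.
  separate-step : ∀ {n K} (G : Graph n) E (u : Fin K → Fin n) (R : Fin K → Fin K → Bool) → 0 < n → Far G E u R →
    ∃ λ x → suc E * count₂ (λ i j → R i j ∧ not (differ (adj G (u i) x) (adj G (u j) x))) ≤ E * count₂ R
  separate-step {n} {K} G E u R n>0 far = x , +-cancelˡ-≤ (suc E * sep x) _ _ bound
    where
    sep stay : Fin n → ℕ
    sep x  = count₂ (λ i j → R i j ∧ differ (adj G (u i) x) (adj G (u j) x))
    stay x = count₂ (λ i j → R i j ∧ not (differ (adj G (u i) x) (adj G (u j) x)))
    split : ∀ x → count₂ R ≡ sep x + stay x
    split x = trans (sum-cong K (λ i → trans (sum-cong K (λ j → pointwise (R i j) _)) (sum-+ K _ _))) (sum-+ K _ _)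
      where
      pointwise : ∀ r d → ⟦ r ⟧ ≡ ⟦ r ∧ d ⟧ + ⟦ r ∧ not d ⟧
      pointwise true  true  = refl
      pointwise true  false = refl
      pointwise false d     = refl
    pair : ∀ i j → n * ⟦ R i j ⟧ ≤ sumFin n (λ x → suc E * ⟦ R i j ∧ differ (adj G (u i) x) (adj G (u j) x) ⟧)
    pair i j with R i j in eq
    ... | false = ≤-trans (≤-reflexive (*-zeroʳ n)) z≤n
    ... | true  = ≤-trans (≤-reflexive (*-identityʳ n)) (≤-trans (far i j eq) (≤-reflexive (sym (sum-*ˡ n (suc E) _))))
    total : n * count₂ R ≤ sumFin n (λ x → suc E * sep x)
    total = begin
      n * count₂ R ≡⟨ sym (trans (sum-cong K (λ i → sum-*ˡ K n _)) (sum-*ˡ K n _)) ⟩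
      sumFin K (λ i → sumFin K (λ j → n * ⟦ R i j ⟧)) ≤⟨ sum-mono K (λ i → sum-mono K (pair i)) ⟩
      sumFin K (λ i → sumFin K (λ j → sumFin n (λ x → suc E * ⟦ R i j ∧ differ (adj G (u i) x) (adj G (u j) x) ⟧)))
        ≡⟨ sum-cong K (λ i → sum-swap K n _) ⟩
      sumFin K (λ i → sumFin n (λ x → sumFin K (λ j → suc E * ⟦ R i j ∧ differ (adj G (u i) x) (adj G (u j) x) ⟧)))
        ≡⟨ sum-swap K n _ ⟩
      sumFin n (λ x → sumFin K (λ i → sumFin K (λ j → suc E * ⟦ R i j ∧ differ (adj G (u i) x) (adj G (u j) x) ⟧)))
        ≡⟨ sum-cong n (λ x → trans (sum-cong K (λ i → sum-*ˡ K (suc E) _)) (sum-*ˡ K (suc E) _)) ⟩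
      sumFin n (λ x → suc E * sep x) ∎
      where open ≤-Reasoning
    x : Fin n
    x = proj₁ (sum-average n (count₂ R) _ n>0 total)
    bound : suc E * sep x + suc E * stay x ≤ suc E * sep x + E * count₂ R
    bound = begin
      suc E * sep x + suc E * stay x ≡⟨ sym (*-distribˡ-+ (suc E) (sep x) (stay x)) ⟩
      suc E * (sep x + stay x)       ≡⟨ cong (suc E *_) (sym (split x)) ⟩
      count₂ R + E * count₂ R        ≤⟨ +-monoˡ-≤ (E * count₂ R) (proj₂ (sum-average n (count₂ R) _ n>0 total)) ⟩
      suc E * sep x + E * count₂ R   ∎
      where open ≤-Reasoning

  -- Each chosen vertex leaves at most the fraction `E / (E + 1)` of the far pairs unseparated, so
  -- the numerical hypothesis leaves fewer than one pair after `t` choices.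
  separate : ∀ {n K} (G : Graph n) E (u : Fin K → Fin n) → 0 < n → ∀ t (R : Fin K → Fin K → Bool) → Far G E u R →
    E ^ t * count₂ R < suc E ^ t →
    ∃ λ (xs : Vec (Fin n) t) → ∀ i j → R i j ≡ true → trace G xs (u i) ≢ trace G xs (u j)
  separate {K = K} G E u n>0 zero R far lt = [] , λ i j Rij _ → contradiction lt
    (≤⇒≯ (≤-trans (≤-trans (≤-reflexive (cong ⟦_⟧ (sym Rij)))
      (≤-trans (term≤sum K (λ j → ⟦ R i j ⟧) j) (term≤sum K _ i))) (m≤m+n _ 0)))
  separate {n} {K} G E u n>0 (suc t) R far lt = x ∷ proj₁ rest , λ i j Rij eq →
    proj₂ rest i j (stays (Vec.∷-injectiveˡ eq) Rij) (Vec.∷-injectiveʳ eq)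
    where
    x : Fin n
    x = proj₁ (separate-step G E u R n>0 far)
    R′ : Fin K → Fin K → Bool
    R′ i j = R i j ∧ not (differ (adj G (u i) x) (adj G (u j) x))
    stays : ∀ {r a b} → a ≡ b → r ≡ true → r ∧ not (differ a b) ≡ true
    stays {a = a} {b} e refl with a Bool.≟ b
    ... | yes _ = refl
    ... | no ¬e = contradiction e ¬e
    lt′ : E ^ t * count₂ R′ < suc E ^ t
    lt′ = *-cancelˡ-< (suc E) _ _ (begin-strict
      suc E * (E ^ t * count₂ R′) ≡⟨ swap (suc E) (E ^ t) (count₂ R′) ⟩
      E ^ t * (suc E * count₂ R′) ≤⟨ *-monoʳ-≤ (E ^ t) (proj₂ (separate-step G E u R n>0 far)) ⟩
      E ^ t * (E * count₂ R)      ≡⟨ assoc (E ^ t) E (count₂ R) ⟩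
      E ^ suc t * count₂ R        <⟨ lt ⟩
      suc E ^ suc t               ∎)
      where
      open ≤-Reasoning
      swap : ∀ a b c → a * (b * c) ≡ b * (a * c)
      swap = solve-∀
      assoc : ∀ a b c → a * (b * c) ≡ b * a * c
      assoc = solve-∀
    rest : ∃ λ (xs : Vec (Fin n) t) → ∀ i j → R′ i j ≡ true → trace G xs (u i) ≢ trace G xs (u j)
    rest = separate G E u n>0 t R′ (λ i j r → far i j (proj₁ (∧-true r))) lt′

  n<2^n : ∀ n → n < 2 ^ n
  n<2^n zero    = s≤s z≤n
  n<2^n (suc n) = begin-strict
    1 + n             <⟨ +-mono-≤-< (m^n>0 2 n) (n<2^n n) ⟩
    2 ^ n + 2 ^ n     ≡⟨ cong (2 ^ n +_) (sym (+-identityʳ _)) ⟩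
    2 ^ suc n         ∎
    where open ≤-Reasoning

  -- The exponent is split into two halves `z`: one power `2 ^ z` beats the coefficient `C + C`, the
  -- other beats `z`.
  linear<exp : ∀ C → ∃ λ y → 0 < y × C * y < 2 ^ y
  linear<exp C = z + z , s≤s z≤n , (begin-strict
    C * (z + z)     ≡⟨ double C z ⟩
    (C + C) * z     ≤⟨ *-mono-≤ (<⇒≤ (<-trans (n<1+n (C + C)) (n<2^n z))) (≤-refl {z}) ⟩
    2 ^ z * z       <⟨ *-monoʳ-< (2 ^ z) {{>-nonZero (m^n>0 2 z)}} (n<2^n z) ⟩
    2 ^ z * 2 ^ z   ≡⟨ sym (^-distribˡ-+-* 2 z z) ⟩
    2 ^ (z + z)     ∎)
    where
    open ≤-Reasoning
    z = suc (C + C)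
    double : ∀ C z → C * (z + z) ≡ (C + C) * z
    double = solve-∀

  -- With `j` a multiple of `suc d`, both sides become powers with exponent `suc d` and `linear<exp`
  -- compares the bases. Raising `d` to `suc d` keeps the comparison strict when `d` is zero.
  poly<exp : ∀ C d → ∃ λ j → 0 < j × (C * j) ^ d < 2 ^ j
  poly<exp zero zero = 1 , s≤s z≤n , s≤s (s≤s z≤n)
  poly<exp zero (suc d) = 1 , s≤s z≤n , s≤s z≤n
  poly<exp C@(suc _) d with linear<exp (C * suc d)
  ... | y@(suc _) , _ , lt = y * suc d , s≤s z≤n , (begin-strict
    (C * (y * suc d)) ^ d       ≤⟨ ^-monoʳ-≤ (C * (y * suc d)) (n≤1+n d) ⟩
    (C * (y * suc d)) ^ suc d   ≡⟨ cong (_^ suc d) (reorder C y (suc d)) ⟩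
    (C * suc d * y) ^ suc d     <⟨ ^-monoˡ-< (suc d) lt ⟩
    (2 ^ y) ^ suc d             ≡⟨ ^-*-assoc 2 y (suc d) ⟩
    2 ^ (y * suc d)             ∎)
    where
    open ≤-Reasoning
    reorder : ∀ C y e → C * (y * e) ≡ C * e * y
    reorder = solve-∀

  ^-distrib-* : ∀ a b m → (a * b) ^ m ≡ a ^ m * b ^ m
  ^-distrib-* a b zero    = refl
  ^-distrib-* a b (suc m) = trans (cong (a * b *_) (^-distrib-* a b m)) (interchange a b (a ^ m) (b ^ m))
    where
    interchange : ∀ a b x y → a * b * (x * y) ≡ a * x * (b * y)
    interchange = solve-∀

  bernoulli : ∀ E m → E ^ suc m + suc m * E ^ m ≤ suc E ^ suc m
  bernoulli E zero    = ≤-reflexive (base E)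
    where
    base : ∀ E → E * 1 + 1 ≡ suc E * 1
    base = solve-∀
  bernoulli E (suc m) = begin
    E * (E * E ^ m) + suc (suc m) * (E * E ^ m)                 ≤⟨ m≤m+n _ (suc m * E ^ m) ⟩
    E * (E * E ^ m) + suc (suc m) * (E * E ^ m) + suc m * E ^ m ≡⟨ expand E (E ^ m) m ⟩
    suc E * (E * E ^ m + suc m * E ^ m)                         ≤⟨ *-monoʳ-≤ (suc E) (bernoulli E m) ⟩
    suc E * suc E ^ suc m                                       ∎
    where
    open ≤-Reasoning
    expand : ∀ E x m → E * (E * x) + suc (suc m) * (E * x) + suc m * x ≡ suc E * (E * x + suc m * x)
    expand = solve-∀

  -- This is `(1 + 1/E) ^ (E + 1) ≥ 2`: every `E + 1` choices halve the number of unseparated pairs.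
  halving : ∀ E → 2 * E ^ suc E ≤ suc E ^ suc E
  halving E = begin
    2 * E ^ suc E                ≤⟨ ≤-reflexive (cong (E ^ suc E +_) (+-identityʳ _)) ⟩
    E ^ suc E + E * E ^ E        ≤⟨ +-monoʳ-≤ (E ^ suc E) (*-monoˡ-≤ (E ^ E) (n≤1+n E)) ⟩
    E ^ suc E + suc E * E ^ E    ≤⟨ bernoulli E E ⟩
    suc E ^ suc E                ∎
    where open ≤-Reasoning

  -- Some vertex realises the indicator of `a`, and it could not tell `a` from another index with
  -- the same image. This supplies the injectivity in `VCdim≤`, which the Sauer-Shelah coordinates
  -- do not carry.
  shattered⇒injective : ∀ {n k} (G : Graph n) (f : Fin k → Fin n) → Shattered G k f → Injective _≡_ _≡_ f
  shattered⇒injective G f sh {a} {b} e = decidable-stable (a Fin.≟ b) λ ¬p →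
    contradiction (trans (sym (at a (⌊⌋-true (a Fin.≟ a) refl)))
      (trans (cong (adj G v) e) (at b (⌊⌋-false (b Fin.≟ a) (¬p ∘ sym))))) λ ()
    where
    v = proj₁ (sh (tabulate (λ i → ⌊ i Fin.≟ a ⌋)))
    at : ∀ i {r} → ⌊ i Fin.≟ a ⌋ ≡ r → adj G v (f i) ≡ r
    at i q = trans (proj₂ (sh (tabulate (λ i → ⌊ i Fin.≟ a ⌋))) i) (trans (Vec.lookup∘tabulate _ i) q)

  -- The second numerical hypothesis allows enough choices to separate all of the at most `K * K`
  -- pairs; the first makes the resulting `K` distinct traces too many for VC-dimension `d`.
  packing-bound : ∀ E d t K → sauer t (suc d) < K → E ^ t * (K * K) < suc E ^ t →
    ∀ {n} (G : Graph n) → VCdim≤ d G → 0 < n → (u : Fin K → Fin n) →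
    (∀ i j → i ≢ j → n ≤ suc E * diff G (u i) (u j)) → ⊥
  packing-bound E d t K few-traces enough-steps {n} G vc n>0 u far = contradiction (vc (suc d) (lookup xs ∘ g) inj shattered) (<⇒≱ (n<1+n d))
    where
    distinct : Fin K → Fin K → Bool
    distinct i j = ⌊ ¬? (i Fin.≟ j) ⌋
    pairs≤ : count₂ distinct ≤ K * K
    pairs≤ = ≤-trans (sum-mono K (λ i → count≤ (distinct i))) (≤-reflexive (sum-const K K))
    separated = separate G E u n>0 t distinct (λ i j r → far i j (⌊⌋-sound (¬? (i Fin.≟ j)) r))
      (≤-<-trans (*-monoʳ-≤ (E ^ t) pairs≤) enough-steps)
    xs : Vec (Fin n) t
    xs = proj₁ separated
    tr : Fin K → Vec Bool t
    tr i = trace G xs (u i)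
    tr-inj : ∀ {i j} → tr i ≡ tr j → i ≡ j
    tr-inj {i} {j} eq = decidable-stable (i Fin.≟ j)
      λ ¬p → proj₂ separated i j (⌊⌋-true (¬? (i Fin.≟ j)) ¬p) eq
    realized? : ∀ c → Dec (∃ λ i → tr i ≡ c)
    realized? c = Fin.any? (λ i → Vec.≡-dec Bool._≟_ (tr i) c)
    P : Vec Bool t → Bool
    P c = ⌊ realized? c ⌋
    P-tr : ∀ i → P (tr i) ≡ true
    P-tr i = ⌊⌋-true (realized? (tr i)) (i , refl)
    K≤ : K ≤ countV t P
    K≤ = Fin.injective⇒≤ {f = λ i → indexV P (tr i) (P-tr i)} λ e → tr-inj (indexV-injective P _ _ _ _ e)
    ss = sauer-shelah t (suc d) P (<-≤-trans few-traces K≤)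
    g = proj₁ ss
    shattered : Shattered G (suc d) (lookup xs ∘ g)
    shattered B with c , Pc , eq ← proj₂ ss B with i , refl ← ⌊⌋-sound (realized? c) Pc =
      u i , λ a → trans (sym (Vec.lookup-map (g a) (adj G (u i)) xs)) (eq a)
    inj : Injective _≡_ _≡_ (lookup xs ∘ g)
    inj = shattered⇒injective G (lookup xs ∘ g) shattered

  -- Since `j` is positive, one more than `D * suc (j + j)` is at most `(3 * D + 1) * j`; this is
  -- the origin of the coefficient passed to `poly<exp`.
  few-traces : ∀ D d j → 0 < j → (suc (3 * D) * j) ^ d < 2 ^ j → sauer (D * suc (j + j)) (suc d) < 2 ^ j
  few-traces D d j@(suc i) _ poly = begin-strict
    sauer (D * suc (j + j)) (suc d) ≤⟨ sauer≤ (D * suc (j + j)) d ⟩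
    suc (D * suc (j + j)) ^ d       ≤⟨ ^-monoˡ-≤ d (≤-trans (m≤m+n _ (D * i + i)) (≤-reflexive (expand D i))) ⟩
    (suc (3 * D) * j) ^ d           <⟨ poly ⟩
    2 ^ j                           ∎
    where
    open ≤-Reasoning
    expand : ∀ D i → suc (D * suc (suc i + suc i)) + (D * i + i) ≡ suc (3 * D) * suc i
    expand = solve-∀

  -- The `D * m` choices form `m` blocks, each of which halves the number of surviving pairs.
  enough-steps : ∀ E D m Q → 0 < E → 2 * E ^ D ≤ D ^ D → Q < 2 ^ m → E ^ (D * m) * Q < D ^ (D * m)
  enough-steps E@(suc _) D m Q _ half Q< = begin-strict
    E ^ (D * m) * Q         <⟨ *-monoʳ-< (E ^ (D * m)) {{>-nonZero (m^n>0 E (D * m))}} Q< ⟩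
    E ^ (D * m) * 2 ^ m     ≡⟨ cong (_* 2 ^ m) (sym (^-*-assoc E D m)) ⟩
    (E ^ D) ^ m * 2 ^ m     ≡⟨ *-comm ((E ^ D) ^ m) (2 ^ m) ⟩
    2 ^ m * (E ^ D) ^ m     ≡⟨ sym (^-distrib-* 2 (E ^ D) m) ⟩
    (2 * E ^ D) ^ m         ≤⟨ ^-monoˡ-≤ m half ⟩
    (D ^ D) ^ m             ≡⟨ ^-*-assoc D D m ⟩
    D ^ (D * m)             ∎
    where open ≤-Reasoning

  2^j*2^j< : ∀ j → 2 ^ j * 2 ^ j < 2 ^ suc (j + j)
  2^j*2^j< j = subst (_< 2 ^ suc (j + j)) (^-distribˡ-+-* 2 j j) (^-monoʳ-< 2 (s≤s (s≤s z≤n)) (n<1+n (j + j)))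

  -- Separating `K` vertices takes a number of choices logarithmic in `K`, while the number of
  -- traces is polynomial in the number of choices. So a large `K = 2 ^ j` is impossible, and it
  -- depends only on `E` and `d`.
  packing : ∀ E d → 0 < E → ∃ λ K → ∀ {n} (G : Graph n) → VCdim≤ d G → 0 < n → (u : Fin K → Fin n) →
    (∀ i j → i ≢ j → n ≤ suc E * diff G (u i) (u j)) → ⊥
  packing E d E>0 = 2 ^ j , packing-bound E d (suc E * suc (j + j)) (2 ^ j)
    (few-traces (suc E) d j j>0 poly)
    (enough-steps E (suc E) (suc (j + j)) _ E>0 (halving E) (2^j*2^j< j))
    where
    j = proj₁ (poly<exp (suc (3 * suc E)) d)
    j>0 = proj₁ (proj₂ (poly<exp (suc (3 * suc E)) d))
    poly = proj₂ (proj₂ (poly<exp (suc (3 * suc E)) d))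

  -- Small independence number and edges with similar ends.

  IndependenceBound : ∀ {n} → ℕ → Graph n → Set
  IndependenceBound {n} g G = ∀ k → HasIndependentSet k G → k * g ≤ n

  independence-weaken : ∀ {n g g′} (G : Graph n) → g ≤ g′ → IndependenceBound g′ G → IndependenceBound g G
  independence-weaken G le ind k I = ≤-trans (*-monoʳ-≤ k le) (ind k I)

  independent-count : ∀ {n g} (G : Graph n) → IndependenceBound g G → (B : Fin n → Bool) →
    (∀ u v → B u ≡ true → B v ≡ true → adj G u v ≡ false) → count B * g ≤ n
  independent-count G ind B indep with f , inj , ok ← enum B =
    ind (count B) (f , inj , λ i j → indep (f i) (f j) (ok i) (ok j))

  Edge : ∀ {n} → Graph n → (Fin n → Bool) → Fin n → Fin n → Set
  Edge G B u v = B u ≡ true × B v ≡ true × adj G u v ≡ true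

  edge? : ∀ {n} (G : Graph n) (B : Fin n → Bool) → Dec (∃ λ u → ∃ λ v → Edge G B u v)
  edge? G B = Fin.any? λ u → Fin.any? λ v → (B u Bool.≟ true) ×-dec ((B v Bool.≟ true) ×-dec (adj G u v Bool.≟ true))

  large⇒edge : ∀ {n g} (G : Graph n) → IndependenceBound g G → (B : Fin n → Bool) → n < count B * g →
    ∃ λ u → ∃ λ v → Edge G B u v
  large⇒edge G ind B lt = decidable-stable (edge? G B) λ none → contradiction lt
    (≤⇒≯ (independent-count G ind B λ u v Bu Bv → ¬true⇒false λ uv → none (u , v , Bu , Bv , uv)))

  differ-sym : ∀ a b → differ a b ≡ differ b a
  differ-sym true  true  = refl
  differ-sym true  false = refl
  differ-sym false true  = refl
  differ-sym false false = refl

  diff-sym : ∀ {n} (G : Graph n) u v → diff G u v ≡ diff G v u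
  diff-sym {n} G u v = sum-cong n λ x → cong ⟦_⟧ (differ-sym (adj G u x) (adj G v x))

  diff-triangle : ∀ {n} (G : Graph n) u v w → diff G v w ≤ diff G u v + diff G u w
  diff-triangle {n} G u v w = ≤-trans (sum-mono n λ x → pointwise (adj G u x) (adj G v x) (adj G w x))
                                      (≤-reflexive (sum-+ n _ _))
    where
    pointwise : ∀ a b c → ⟦ differ b c ⟧ ≤ ⟦ differ a b ⟧ + ⟦ differ a c ⟧
    pointwise true  true  true  = z≤n
    pointwise true  true  false = s≤s z≤n
    pointwise true  false true  = s≤s z≤n
    pointwise true  false false = z≤n
    pointwise false true  true  = z≤n
    pointwise false true  false = s≤s z≤n
    pointwise false false true  = s≤s z≤n
    pointwise false false false = z≤n

  count-split : ∀ {n} (R C : Fin n → Bool) → count R ≡ count (λ x → R x ∧ C x) + count (λ x → R x ∧ not (C x))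
  count-split {n} R C = trans (sum-cong n λ x → pointwise (R x) (C x)) (sum-+ n _ _)
    where
    pointwise : ∀ r c → ⟦ r ⟧ ≡ ⟦ r ∧ c ⟧ + ⟦ r ∧ not c ⟧
    pointwise true  true  = refl
    pointwise true  false = refl
    pointwise false c     = refl

  not-⌊⌋-sound : ∀ {P : Set} (d : Dec P) → not ⌊ d ⌋ ≡ true → ¬ P
  not-⌊⌋-sound (no ¬p) _ = ¬p

  close : ∀ {n} → Graph n → ℕ → Fin n → Fin n → Bool
  close {n} G E u v = ⌊ suc E * diff G u v <? n ⌋

  Scattered : ∀ {n} → Graph n → ℕ → (Fin n → Bool) → ℕ → Set
  Scattered {n} G E R k = ∃ λ (u : Fin k → Fin n) → (∀ i → R (u i) ≡ true) ×
    (∀ i j → i ≢ j → n ≤ suc E * diff G (u i) (u j))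

  -- Greedy choice of centres: removing a ball that is not large lowers `count R * g` by at most
  -- `n`, so the hypothesis pays for `k` rounds.
  large-ball-or-scattered : ∀ {n} (G : Graph n) E g k (R : Fin n → Bool) → k * n < count R * g →
    (∃ λ u → n < count (λ v → R v ∧ close G E u v) * g) ⊎ Scattered G E R k
  large-ball-or-scattered G E g zero R lt = inj₂ ((λ ()) , (λ ()) , λ ())
  large-ball-or-scattered {n} G E g (suc k) R lt with count>0⇒∃ R (pos (count R) lt)
    where
    pos : ∀ c → suc k * n < c * g → 0 < c
    pos (suc c) _ = s≤s z≤n
  ... | u , Ru with n <? count (λ v → R v ∧ close G E u v) * g
  ...   | yes big = inj₁ (u , big)
  ...   | no small with large-ball-or-scattered G E g k (λ v → R v ∧ not (close G E u v)) (+-cancelˡ-< n _ _ remaining)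
    where
    remaining : n + k * n < n + count (λ v → R v ∧ not (close G E u v)) * g
    remaining = <-≤-trans lt (≤-trans
      (≤-reflexive (trans (cong (_* g) (count-split R (close G E u))) (*-distribʳ-+ g (count (λ v → R v ∧ close G E u v)) _)))
      (+-monoˡ-≤ _ (≮⇒≥ small)))
  ...     | inj₁ (w , big) = inj₁ (w , <-≤-trans big (*-monoˡ-≤ g (sum-mono n λ v → drop (R v) _ _)))
    where
    drop : ∀ r a b → ⟦ (r ∧ a) ∧ b ⟧ ≤ ⟦ r ∧ b ⟧
    drop true  true  b = ≤-refl
    drop true  false b = z≤n
    drop false a     b = z≤n
  ...     | inj₂ (us , in-R , far) = inj₂ (us′ , in-R′ , far′)
    where
    us′ : Fin (suc k) → Fin n
    us′ zero    = u
    us′ (suc i) = us i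
    in-R′ : ∀ i → R (us′ i) ≡ true
    in-R′ zero    = Ru
    in-R′ (suc i) = proj₁ (∧-true (in-R i))
    far₀ : ∀ i → n ≤ suc E * diff G u (us i)
    far₀ i = ≮⇒≥ (not-⌊⌋-sound (suc E * diff G u (us i) <? n) (proj₂ (∧-true {R (us i)} (in-R i))))
    far′ : ∀ i j → i ≢ j → n ≤ suc E * diff G (us′ i) (us′ j)
    far′ zero    zero    ne = contradiction refl ne
    far′ zero    (suc j) ne = far₀ j
    far′ (suc i) zero    ne = subst (λ δ → n ≤ suc E * δ) (diff-sym G u (us i)) (far₀ i)
    far′ (suc i) (suc j) ne = far i j (ne ∘ cong suc)

  SimilarEdge : ∀ {n} → Graph n → ℕ → (Fin n → Bool) → Fin n → Fin n → Set
  SimilarEdge {n} G E B u v = Edge G B u v × suc E * diff G u v ≤ n + n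

  -- Packing rules out `K` scattered vertices, so some ball meets `B` in more than `n / g` vertices
  -- and contains an edge. Both ends are close to the centre, and the triangle inequality gives the
  -- `n + n` of `SimilarEdge`.
  similar-edge : ∀ E d h → 0 < E → ∃ λ g → ∀ {n} (G : Graph n) → VCdim≤ d G → 0 < n → IndependenceBound g G →
    ∀ B → n ≤ h * count B → ∃ λ u → ∃ λ v → SimilarEdge G E B u v
  -- `g` is chosen so that `K` small balls cannot exhaust `B`: `K * n ≤ K * (h * count B) < count B
  -- * suc (K * h)`.
  similar-edge E d h E>0 = suc (K * h) , find
    where
    K = proj₁ (packing E d E>0)
    find : ∀ {n} (G : Graph n) → VCdim≤ d G → 0 < n → IndependenceBound (suc (K * h)) G →
      ∀ B → n ≤ h * count B → ∃ λ u → ∃ λ v → SimilarEdge G E B u v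
    find {n} G vc n>0 ind B large = conclude (large-ball-or-scattered G E (suc (K * h)) K B many)
      where
      pos : ∀ c → n ≤ h * c → 0 < c
      pos zero    le = contradiction (≤-trans n>0 (≤-trans le (≤-reflexive (*-zeroʳ h)))) λ ()
      pos (suc c) _  = s≤s z≤n
      rearrange : ∀ c K h → c * suc (K * h) ≡ c + K * (h * c)
      rearrange = solve-∀
      many : K * n < count B * suc (K * h)
      many = <-≤-trans (+-mono-<-≤ (pos (count B) large) (*-monoʳ-≤ K large)) (≤-reflexive (sym (rearrange (count B) K h)))
      conclude : (∃ λ u → n < count (λ v → B v ∧ close G E u v) * suc (K * h)) ⊎ Scattered G E B K →
        ∃ λ u → ∃ λ v → SimilarEdge G E B u v
      conclude (inj₂ (us , _ , far)) = ⊥-elim (proj₂ (packing E d E>0) G vc n>0 us far)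
      conclude (inj₁ (u , big)) with v , w , Bv , Bw , vw ← large⇒edge G ind _ big =
        v , w , (proj₁ (∧-true Bv) , proj₁ (∧-true Bw) , vw) , (begin
          suc E * diff G v w                        ≤⟨ *-monoʳ-≤ (suc E) (diff-triangle G u v w) ⟩
          suc E * (diff G u v + diff G u w)         ≡⟨ *-distribˡ-+ (suc E) (diff G u v) _ ⟩
          suc E * diff G u v + suc E * diff G u w   ≤⟨ +-mono-≤ (near v Bv) (near w Bw) ⟩
          n + n                                     ∎)
        where
        open ≤-Reasoning
        near : ∀ x → B x ∧ close G E u x ≡ true → suc E * diff G u x ≤ n
        near x p = <⇒≤ (⌊⌋-sound (suc E * diff G u x <? n) (proj₂ (∧-true {B x} p)))

  -- The upper bound: Erdős' degree majorization along similar edges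

  CliqueIn : ∀ {n} → Graph n → (Fin n → Bool) → ℕ → Set
  CliqueIn {n} G A q = ∃ λ (f : Fin q → Fin n) →
    (∀ i → A (f i) ≡ true) × (∀ i j → i ≢ j → adj G (f i) (f j) ≡ true)

  common : ∀ {n} → Graph n → (Fin n → Bool) → Fin n → Fin n → Fin n → Bool
  common G A u v x = A x ∧ (adj G u x ∧ adj G v x)

  extend-clique : ∀ {n q} (G : Graph n) A {u v} → Edge G A u v → CliqueIn G (common G A u v) q →
    CliqueIn G A (suc (suc q))
  extend-clique {n} {q} G A {u} {v} (Au , Av , uv) (f , inA , clique) = f′ , inA′ , clique′
    where
    f′ : Fin (suc (suc q)) → Fin n
    f′ zero          = u
    f′ (suc zero)    = v
    f′ (suc (suc i)) = f i
    nbrs : ∀ i → adj G u (f i) ≡ true × adj G v (f i) ≡ true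
    nbrs i = ∧-true (proj₂ (∧-true {A (f i)} (inA i)))
    inA′ : ∀ i → A (f′ i) ≡ true
    inA′ zero          = Au
    inA′ (suc zero)    = Av
    inA′ (suc (suc i)) = proj₁ (∧-true (inA i))
    clique′ : ∀ i j → i ≢ j → adj G (f′ i) (f′ j) ≡ true
    clique′ zero          zero          ne = contradiction refl ne
    clique′ zero          (suc zero)    ne = uv
    clique′ zero          (suc (suc j)) ne = proj₁ (nbrs j)
    clique′ (suc zero)    zero          ne = trans (adj-sym G v u) uv
    clique′ (suc zero)    (suc zero)    ne = contradiction refl ne
    clique′ (suc zero)    (suc (suc j)) ne = proj₂ (nbrs j)
    clique′ (suc (suc i)) zero          ne = trans (adj-sym G (f i) u) (proj₁ (nbrs i))
    clique′ (suc (suc i)) (suc zero)    ne = trans (adj-sym G (f i) v) (proj₂ (nbrs i))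
    clique′ (suc (suc i)) (suc (suc j)) ne = clique i j (λ e → ne (cong (λ k → suc (suc k)) e))

  deg : ∀ {n} → Graph n → (Fin n → Bool) → Fin n → ℕ
  deg G A x = count (λ y → A y ∧ adj G x y)

  -- Ordered pairs are counted, so this is twice the number of edges inside A.
  edges : ∀ {n} → Graph n → (Fin n → Bool) → ℕ
  edges G A = count₂ (λ x y → A x ∧ (A y ∧ adj G x y))

  last-true : ∀ {P : ℕ → Set} → (∀ m → Dec (P m)) → ∀ N → P 0 → ¬ P N → ∃ λ T → P T × ¬ P (suc T)
  last-true P? zero    p0 ¬pN = contradiction p0 ¬pN
  last-true P? (suc N) p0 ¬pN with P? N
  ... | yes pN = N , pN , ¬pN
  ... | no ¬pN′ = last-true P? N p0 ¬pN′

  high : ∀ {n} → Graph n → (Fin n → Bool) → ℕ → Fin n → Bool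
  high G A T x = A x ∧ ⌊ T ≤? deg G A x ⌋

  -- Erdős' degree majorization: outside the common neighbourhood of u and v the
  -- degrees are at most T, up to the few vertices of degree above T.
  degree-majorization : ∀ {n} (G : Graph n) A u v T c → let m = count (common G A u v) in
    count A ≡ m + c → T ≤ m + diff G u v →
    edges G A ≤ edges G (common G A u v) + 2 * (c * m) + 2 * (diff G u v * c + n * count (high G A (suc T)))
  degree-majorization {n} G A u v T c sizes T≤ = begin
    edges G A                                              ≤⟨ sum-mono n (λ x → sum-mono n (pointwise x)) ⟩
    sumFin n (λ x → sumFin n (λ y → ⟦ inner x y ⟧ + ⟦ cross x y ⟧ + ⟦ cross y x ⟧))
      ≡⟨ trans (sum-cong n λ x → trans (sum-+ n _ _) (cong (_+ count (λ y → cross y x)) (sum-+ n _ _)))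
           (trans (sum-+ n _ _) (cong (_+ count₂ (λ x y → cross y x)) (sum-+ n _ _))) ⟩
    edges G A′ + outer + count₂ (λ x y → cross y x)        ≡⟨ cong (edges G A′ + outer +_) (sum-swap n n _) ⟩
    edges G A′ + outer + outer                             ≡⟨ regroup (edges G A′) outer ⟩
    edges G A′ + 2 * outer                                 ≤⟨ +-monoʳ-≤ (edges G A′) (*-monoʳ-≤ 2 outer≤) ⟩
    edges G A′ + 2 * (T * c + n * b)                       ≤⟨ +-monoʳ-≤ (edges G A′) (*-monoʳ-≤ 2 (+-monoˡ-≤ (n * b) (*-monoˡ-≤ c T≤))) ⟩
    edges G A′ + 2 * ((m + δ) * c + n * b)                 ≡⟨ expand (edges G A′) m δ c (n * b) ⟩
    edges G A′ + 2 * (c * m) + 2 * (δ * c + n * b)         ∎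
    where
    open ≤-Reasoning
    A′ C : Fin n → Bool
    A′ = common G A u v
    C x = A x ∧ not (adj G u x ∧ adj G v x)
    inner cross : Fin n → Fin n → Bool
    inner x y = A′ x ∧ (A′ y ∧ adj G x y)
    cross x y = C x ∧ (A y ∧ adj G x y)
    m δ b outer : ℕ
    m = count A′
    δ = diff G u v
    b = count (high G A (suc T))
    outer = count₂ cross
    -- An edge in `A` lies in the common neighbourhood or has an end in `C`; counting the second
    -- kind once from each end may count edges inside `C` twice, which only helps the upper bound.
    pointwise : ∀ x y → ⟦ A x ∧ (A y ∧ adj G x y) ⟧ ≤ ⟦ inner x y ⟧ + ⟦ cross x y ⟧ + ⟦ cross y x ⟧
    pointwise x y rewrite adj-sym G y x
      with A x | A y | adj G x y | adj G u x ∧ adj G v x | adj G u y ∧ adj G v y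
    ... | false | _     | _     | _     | _     = z≤n
    ... | true  | false | _     | _     | _     = z≤n
    ... | true  | true  | false | _     | _     = z≤n
    ... | true  | true  | true  | true  | true  = s≤s z≤n
    ... | true  | true  | true  | true  | false = s≤s z≤n
    ... | true  | true  | true  | false | _     = s≤s z≤n
    C-count : count C ≡ c
    C-count = +-cancelˡ-≡ m _ _ (trans (sym (count-split A (λ x → adj G u x ∧ adj G v x))) sizes)
    row : ∀ x → count (λ y → C x ∧ (A y ∧ adj G x y)) ≤ T * ⟦ C x ⟧ + n * ⟦ high G A (suc T) x ⟧
    row x with A x | adj G u x ∧ adj G v x
    ... | false | _     = ≤-trans (≤-reflexive (trans (sum-const n 0) (*-zeroʳ n))) z≤n
    ... | true  | true  = ≤-trans (≤-reflexive (trans (sum-const n 0) (*-zeroʳ n))) z≤n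
    ... | true  | false with suc T ≤? deg G A x
    ...   | yes _  = ≤-trans (count≤ (λ y → A y ∧ adj G x y)) (≤-trans (≤-reflexive (sym (*-identityʳ n))) (m≤n+m _ (T * 1)))
    ...   | no low = ≤-trans (≤-trans (≤-pred (≰⇒> low)) (≤-reflexive (sym (*-identityʳ T)))) (m≤m+n (T * 1) _)
    outer≤ : outer ≤ T * c + n * b
    outer≤ = ≤-trans (sum-mono n row) (≤-reflexive (trans (sum-+ n _ _)
      (cong₂ _+_ (trans (sum-*ˡ n T _) (cong (T *_) C-count)) (sum-*ˡ n n _))))
    regroup : ∀ a b → a + b + b ≡ a + 2 * b
    regroup = solve-∀
    expand : ∀ a m δ c d → a + 2 * ((m + δ) * c + d) ≡ a + 2 * (c * m) + 2 * (δ * c + d)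
    expand = solve-∀

  deg≤common+diff : ∀ {n} (G : Graph n) A u v → deg G A u ≤ count (common G A u v) + diff G u v
  deg≤common+diff {n} G A u v = ≤-trans (sum-mono n λ x → pointwise (A x) (adj G u x) (adj G v x)) (≤-reflexive (sum-+ n _ _))
    where
    pointwise : ∀ a b c → ⟦ a ∧ b ⟧ ≤ ⟦ a ∧ (b ∧ c) ⟧ + ⟦ differ b c ⟧
    pointwise true  true  true  = s≤s z≤n
    pointwise true  true  false = s≤s z≤n
    pointwise true  false c     = z≤n
    pointwise false b     c     = z≤n

  edges≤ : ∀ {n} (G : Graph n) A → edges G A ≤ count A * count A
  edges≤ {n} G A = ≤-trans (sum-mono n row) (≤-reflexive (sum-*ˡ n (count A) _))
    where
    row : ∀ x → count (λ y → A x ∧ (A y ∧ adj G x y)) ≤ count A * ⟦ A x ⟧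
    row x with A x
    ... | false = ≤-trans (≤-reflexive (trans (sum-const n 0) (*-zeroʳ n))) z≤n
    ... | true  = ≤-trans (sum-mono n λ y → weaken (A y) _) (≤-reflexive (sym (*-identityʳ (count A))))
      where
      weaken : ∀ a b → ⟦ a ∧ b ⟧ ≤ ⟦ a ⟧
      weaken true  b = ⟦⟧≤1 b
      weaken false b = z≤n

  -- One induction step from `A` to a common neighbourhood. Here `c` counts the vertices lost, and
  -- `err` collects the dissimilarity of the ends and the exceptional degrees within a budget
  -- `n * n / X`.
  record Reduction {n} (G : Graph n) (A : Fin n → Bool) (X : ℕ) : Set where
    field
      u v     : Fin n
      edge    : Edge G A u v
      c err   : ℕ
      sizes   : count A ≡ count (common G A u v) + c
      edges≤′ : edges G A ≤ edges G (common G A u v) + 2 * (c * count (common G A u v)) + err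
      err≤    : X * err ≤ n * n

  reduction : ∀ X d → 0 < X → ∃ λ g → ∀ {n} (G : Graph n) → VCdim≤ d G → 0 < n → IndependenceBound g G →
    ∀ A → (X * edges G A ≤ n * n) ⊎ Reduction G A X
  reduction X@(suc X₀) d _ = proj₁ sim , reduce
    where
    -- `suc E` is `8 * X`, so similar ends differ in at most `n / (4 * X)` vertices, and fewer than
    -- `n / (4 * X)` vertices have degree above `T`. With the factor 2 in `err`, each source uses at
    -- most half of the budget.
    E h : ℕ
    E = 7 + 8 * X₀
    h = 4 * X
    sim = similar-edge E d h (s≤s z≤n)
    reduce : ∀ {n} (G : Graph n) → VCdim≤ d G → 0 < n → IndependenceBound (proj₁ sim) G →
      ∀ A → (X * edges G A ≤ n * n) ⊎ Reduction G A X
    reduce {n} G vc n>0 ind A with n ≤? h * count (high G A 0)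
    -- Threshold 0 admits all of `A`, so in this case `A` has fewer than `n / (4 * X)` vertices and
    -- the trivial bound on its edges is enough.
    ... | no small = inj₁ (begin
      X * edges G A             ≤⟨ *-monoʳ-≤ X (edges≤ G A) ⟩
      X * (count A * count A)   ≡⟨ sym (*-assoc X (count A) _) ⟩
      X * count A * count A     ≤⟨ *-mono-≤ few (count≤ A) ⟩
      n * n                     ∎)
      where
      open ≤-Reasoning
      all-high : count A ≤ count (high G A 0)
      all-high = sum-mono n λ x → pointwise (A x)
        where
        pointwise : ∀ a → ⟦ a ⟧ ≤ ⟦ a ∧ true ⟧
        pointwise true  = s≤s z≤n
        pointwise false = z≤n
      few : X * count A ≤ n
      few = ≤-trans (*-mono-≤ (m≤m+n X (3 * X)) all-high) (<⇒≤ (≰⇒> small))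
    ... | yes large₀ = inj₂ (found (last-true (λ T → n ≤? h * count (high G A T)) (suc n) large₀ none))
      where
      -- No degree exceeds `n`, so the search for the largest threshold stops before `suc n`.
      none : ¬ (n ≤ h * count (high G A (suc n)))
      none le with count (high G A (suc n)) in eq
      ... | zero  = contradiction (≤-trans n>0 (≤-trans le (≤-reflexive (*-zeroʳ h)))) λ ()
      ... | suc k with x , p ← count>0⇒∃ (high G A (suc n)) (subst (0 <_) (sym eq) (s≤s z≤n)) =
        contradiction (⌊⌋-sound (suc n ≤? deg G A x) (proj₂ (∧-true {A x} p))) (≤⇒≯ (count≤ (λ y → A y ∧ adj G x y)))
      found : (∃ λ T → n ≤ h * count (high G A T) × ¬ (n ≤ h * count (high G A (suc T)))) → Reduction G A X
      found (T , large , small) with u , v , (Bu , Bv , uv) , near ← proj₂ sim G vc n>0 ind (high G A T) large = record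
        { u = u ; v = v
        ; edge = proj₁ (∧-true Bu) , proj₁ (∧-true Bv) , uv
        ; c = c ; err = 2 * (δ * c + n * b)
        ; sizes = count-split A _
        ; edges≤′ = degree-majorization G A u v T c (count-split A _)
            (≤-trans (⌊⌋-sound (T ≤? deg G A u) (proj₂ (∧-true {A u} Bu))) (deg≤common+diff G A u v))
        ; err≤ = *-cancelˡ-≤ 2 (begin
            2 * (X * (2 * (δ * c + n * b)))     ≡⟨ rearrange X δ c n b ⟩
            4 * X * δ * c + 4 * X * b * n       ≤⟨ +-mono-≤ (*-mono-≤ δ≤ (count≤ _)) (*-monoˡ-≤ n (<⇒≤ (≰⇒> small))) ⟩
            n * n + n * n                       ≡⟨ cong (n * n +_) (sym (+-identityʳ _)) ⟩
            2 * (n * n)                         ∎)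
        }
        where
        open ≤-Reasoning
        c δ b : ℕ
        c = count (λ x → A x ∧ not (adj G u x ∧ adj G v x))
        δ = diff G u v
        b = count (high G A (suc T))
        δ≤ : 4 * X * δ ≤ n
        δ≤ = *-cancelˡ-≤ 2 (begin
          2 * (4 * X * δ)           ≡⟨ unfold X₀ δ ⟩
          (8 + 8 * X₀) * δ          ≤⟨ near ⟩
          n + n                     ≡⟨ cong (n +_) (sym (+-identityʳ n)) ⟩
          2 * n                     ∎)
          where
          unfold : ∀ X₀ δ → 2 * (4 * suc X₀ * δ) ≡ (8 + 8 * X₀) * δ
          unfold = solve-∀
        rearrange : ∀ X δ c n b → 2 * (X * (2 * (δ * c + n * b))) ≡ 4 * X * δ * c + 4 * X * b * n
        rearrange = solve-∀

  2xy≤x²+y² : ∀ x y → 2 * (x * y) ≤ x * x + y * y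
  2xy≤x²+y² x y with ≤-total x y
  ... | inj₁ x≤y with k , refl ← m≤n⇒∃[o]m+o≡n x≤y = ≤-trans (m≤m+n _ (k * k)) (≤-reflexive (expand x k))
    where
    expand : ∀ x k → 2 * (x * (x + k)) + k * k ≡ x * x + (x + k) * (x + k)
    expand = solve-∀
  ... | inj₂ y≤x with k , refl ← m≤n⇒∃[o]m+o≡n y≤x = ≤-trans (m≤m+n _ (k * k)) (≤-reflexive (expand y k))
    where
    expand : ∀ y k → 2 * ((y + k) * y) + k * k ≡ (y + k) * (y + k) + y * y
    expand = solve-∀

  -- The difference of the two sides is ((t+1)c − m)².
  optimize : ∀ t m c → (2 + t) * (t * (m * m) + 2 * ((1 + t) * (c * m))) ≤ (1 + t) * (1 + t) * ((m + c) * (m + c))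
  optimize t m c = begin
    (2 + t) * (t * (m * m) + 2 * ((1 + t) * (c * m)))
      ≡⟨ lhs t m c ⟩
    t * (2 + t) * (m * m) + 2 * ((1 + t) * (m * x)) + 2 * (x * m)
      ≤⟨ +-monoʳ-≤ (t * (2 + t) * (m * m) + 2 * ((1 + t) * (m * x))) (2xy≤x²+y² x m) ⟩
    t * (2 + t) * (m * m) + 2 * ((1 + t) * (m * x)) + (x * x + m * m)
      ≡⟨ rhs t m c ⟩
    (1 + t) * (1 + t) * ((m + c) * (m + c)) ∎
    where
    open ≤-Reasoning
    x = (1 + t) * c
    lhs : ∀ t m c → (2 + t) * (t * (m * m) + 2 * ((1 + t) * (c * m))) ≡
      t * (2 + t) * (m * m) + 2 * ((1 + t) * (m * ((1 + t) * c))) + 2 * ((1 + t) * c * m)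
    lhs = solve-∀
    rhs : ∀ t m c → t * (2 + t) * (m * m) + 2 * ((1 + t) * (m * ((1 + t) * c))) + ((1 + t) * c * ((1 + t) * c) + m * m) ≡
      (1 + t) * (1 + t) * ((m + c) * (m + c))
    rhs = solve-∀

  -- `X` makes the multiplier `X * (1 + t)` of the induction hypothesis equal to `2 * (1 + t)` times
  -- the desired multiplier of `E`. The quadratic terms are left to `optimize`; the errors are `N`
  -- from the hypothesis and `(1 + t) * N` from `err`, together within `2 * (1 + t) * N`.
  turan-arithmetic : ∀ e t m c E E′ err N → let X = 2 * e * (2 + t) in
    X * (1 + t) * E′ ≤ X * t * (m * m) + N → E ≤ E′ + 2 * (c * m) + err → X * err ≤ N →
    e * (2 + t) * E ≤ e * (1 + t) * ((m + c) * (m + c)) + N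
  turan-arithmetic e t m c E E′ err N ih E≤ err≤ = *-cancelˡ-≤ (2 * (1 + t)) (begin
    2 * (1 + t) * (e * (2 + t) * E)
      ≤⟨ *-monoʳ-≤ (2 * (1 + t)) (*-monoʳ-≤ (e * (2 + t)) E≤) ⟩
    2 * (1 + t) * (e * (2 + t) * (E′ + 2 * (c * m) + err))
      ≡⟨ expand e t m c E′ err ⟩
    X * (1 + t) * E′ + 2 * (X * ((1 + t) * (c * m))) + (1 + t) * (X * err)
      ≤⟨ +-mono-≤ (+-monoˡ-≤ _ ih) (*-monoʳ-≤ (1 + t) err≤) ⟩
    X * t * (m * m) + N + 2 * (X * ((1 + t) * (c * m))) + (1 + t) * N
      ≡⟨ collect e t m c N ⟩
    2 * e * ((2 + t) * (t * (m * m) + 2 * ((1 + t) * (c * m)))) + (2 + t) * N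
      ≤⟨ +-mono-≤ (*-monoʳ-≤ (2 * e) (optimize t m c)) (*-monoˡ-≤ N (≤-trans (m≤m+n (2 + t) t) (≤-reflexive (double t)))) ⟩
    2 * e * ((1 + t) * (1 + t) * ((m + c) * (m + c))) + 2 * (1 + t) * N
      ≡⟨ factor e t ((m + c) * (m + c)) N ⟩
    2 * (1 + t) * (e * (1 + t) * ((m + c) * (m + c)) + N) ∎)
    where
    open ≤-Reasoning
    X = 2 * e * (2 + t)
    double : ∀ t → 2 + t + t ≡ 2 * (1 + t)
    double = solve-∀
    expand : ∀ e t m c E′ err → 2 * (1 + t) * (e * (2 + t) * (E′ + 2 * (c * m) + err)) ≡
      2 * e * (2 + t) * (1 + t) * E′ + 2 * (2 * e * (2 + t) * ((1 + t) * (c * m))) + (1 + t) * (2 * e * (2 + t) * err)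
    expand = solve-∀
    collect : ∀ e t m c N → 2 * e * (2 + t) * t * (m * m) + N + 2 * (2 * e * (2 + t) * ((1 + t) * (c * m))) + (1 + t) * N ≡
      2 * e * ((2 + t) * (t * (m * m) + 2 * ((1 + t) * (c * m)))) + (2 + t) * N
    collect = solve-∀
    factor : ∀ e t a N → 2 * e * ((1 + t) * (1 + t) * a) + 2 * (1 + t) * N ≡ 2 * (1 + t) * (e * (1 + t) * a + N)
    factor = solve-∀

  -- This is `2 * p` for `p = 2 + t`, defined so that `extend-clique` matches one step of the
  -- recursion.
  cliqueSize : ℕ → ℕ
  cliqueSize zero    = 4
  cliqueSize (suc t) = suc (suc (cliqueSize t))

  -- With `p = 2 + t`, the density `t / (1 + t)` is `1 - 1 / (p - 1)`. The main term is relative to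
  -- `A` but the error to the whole graph, so the error survives the passage to smaller sets.
  TuranBound : ∀ {n} → Graph n → (Fin n → Bool) → ℕ → ℕ → Set
  TuranBound {n} G A e t = e * (1 + t) * edges G A ≤ e * t * (count A * count A) + n * n

  -- Both `A` and `e` vary in the induction on `t`: the common neighbourhood replaces `A`, and the
  -- precision must grow from `e` to `2 * e * (2 + t)` to leave room for the new error.
  turan : ∀ d t e → 0 < e → ∃ λ g → ∀ {n} (G : Graph n) → VCdim≤ d G → 0 < n → IndependenceBound g G →
    ∀ A → ¬ CliqueIn G A (cliqueSize t) → TuranBound G A e t
  -- Without `K_4` the common neighbourhood of an edge is independent. The summand `4 * e` bounds it
  -- by `n / (4 * e)`, which makes the cross edges, counted as `2 * (c * m)`, fit into the error.
  turan d zero e@(suc _) _ = proj₁ red + 4 * e , bound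
    where
    red = reduction (2 * e) d (s≤s z≤n)
    bound : ∀ {n} (G : Graph n) → VCdim≤ d G → 0 < n → IndependenceBound (proj₁ red + 4 * e) G →
      ∀ A → ¬ CliqueIn G A 4 → TuranBound G A e 0
    bound {n} G vc n>0 ind A free = ≤-trans (conclude (proj₂ red G vc n>0 (independence-weaken G (m≤m+n _ _) ind) A)) (m≤n+m _ _)
      where
      conclude : (2 * e * edges G A ≤ n * n) ⊎ Reduction G A (2 * e) → e * 1 * edges G A ≤ n * n
      conclude (inj₁ few) = ≤-trans (*-monoˡ-≤ (edges G A) (≤-trans (≤-reflexive (*-identityʳ e)) (m≤m+n e _))) few
      conclude (inj₂ r) = *-cancelˡ-≤ 2 (begin
        2 * (e * 1 * edges G A)                             ≤⟨ *-monoʳ-≤ 2 (*-monoʳ-≤ (e * 1) edges≤′) ⟩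
        2 * (e * 1 * (edges G A′ + 2 * (c * m) + err))      ≡⟨ cong (λ E′ → 2 * (e * 1 * (E′ + 2 * (c * m) + err))) no-edges ⟩
        2 * (e * 1 * (2 * (c * m) + err))                   ≡⟨ expand e c m err ⟩
        m * (4 * e) * c + 2 * e * err                       ≤⟨ +-mono-≤ (*-mono-≤ m≤ c≤) err≤ ⟩
        n * n + n * n                                       ≡⟨ cong (n * n +_) (sym (+-identityʳ _)) ⟩
        2 * (n * n)                                         ∎)
        where
        open ≤-Reasoning
        open Reduction r
        A′ = common G A u v
        m = count A′
        expand : ∀ e c m err → 2 * (e * 1 * (2 * (c * m) + err)) ≡ m * (4 * e) * c + 2 * e * err
        expand = solve-∀
        independent : ∀ x y → A′ x ≡ true → A′ y ≡ true → adj G x y ≡ false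
        independent x y A′x A′y = ¬true⇒false λ xy → free (extend-clique G A edge (f , in-A′ , clique xy))
          where
          f : Fin 2 → Fin n
          f zero       = x
          f (suc zero) = y
          in-A′ : ∀ i → A′ (f i) ≡ true
          in-A′ zero       = A′x
          in-A′ (suc zero) = A′y
          clique : adj G x y ≡ true → ∀ i j → i ≢ j → adj G (f i) (f j) ≡ true
          clique xy zero       zero       ne = contradiction refl ne
          clique xy zero       (suc zero) ne = xy
          clique xy (suc zero) zero       ne = trans (adj-sym G y x) xy
          clique xy (suc zero) (suc zero) ne = contradiction refl ne
        m≤ : m * (4 * e) ≤ n
        m≤ = independent-count G (independence-weaken G (m≤n+m _ (proj₁ red)) ind) A′ independent
        c≤ : c ≤ n
        c≤ = ≤-trans (≤-trans (m≤n+m c m) (≤-reflexive (sym sizes))) (count≤ A)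
        no-edges : edges G A′ ≡ 0
        no-edges = trans (sum-cong n λ x → trans (sum-cong n (zero-term x)) (trans (sum-const n 0) (*-zeroʳ n))) (trans (sum-const n 0) (*-zeroʳ n))
          where
          zero-term : ∀ x y → ⟦ A′ x ∧ (A′ y ∧ adj G x y) ⟧ ≡ 0
          zero-term x y with A′ x in ex
          ... | false = refl
          ... | true with A′ y in ey
          ...   | false = refl
          ...   | true  = cong ⟦_⟧ (independent x y ex ey)
  turan d (suc t) e@(suc _) _ = proj₁ red + proj₁ ih , bound
    where
    X = 2 * e * (2 + t)
    red = reduction X d (s≤s z≤n)
    ih = turan d t X (s≤s z≤n)
    bound : ∀ {n} (G : Graph n) → VCdim≤ d G → 0 < n → IndependenceBound (proj₁ red + proj₁ ih) G →
      ∀ A → ¬ CliqueIn G A (cliqueSize (suc t)) → TuranBound G A e (suc t)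
    bound {n} G vc n>0 ind A free with proj₂ red G vc n>0 (independence-weaken G (m≤m+n _ _) ind) A
    ... | inj₁ few = ≤-trans (≤-trans (*-monoˡ-≤ (edges G A) weaken) few) (m≤n+m _ _)
      where
      weaken : e * (2 + t) ≤ X
      weaken = *-monoˡ-≤ (2 + t) (m≤m+n e _)
    ... | inj₂ r = subst (λ a → e * (2 + t) * edges G A ≤ e * (1 + t) * (a * a) + n * n) (sym sizes)
        (turan-arithmetic e t (count A′) c (edges G A) (edges G A′) err (n * n)
          (proj₂ ih G vc n>0 (independence-weaken G (m≤n+m _ (proj₁ red)) ind) A′ (free ∘ extend-clique G A edge))
          edges≤′ err≤)
      where
      open Reduction r
      A′ = common G A u v

  -- Burling graphs

  sumL : ∀ {A : Set} → (A → ℕ) → List A → ℕ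
  sumL f []       = 0
  sumL f (x ∷ xs) = f x + sumL f xs

  sumL-++ : ∀ {A : Set} (f : A → ℕ) xs ys → sumL f (xs ++ ys) ≡ sumL f xs + sumL f ys
  sumL-++ f []       ys = refl
  sumL-++ f (x ∷ xs) ys = trans (cong (f x +_) (sumL-++ f xs ys)) (sym (+-assoc (f x) _ _))

  sumL-map : ∀ {A B : Set} (f : B → ℕ) (g : A → B) xs → sumL f (List.map g xs) ≡ sumL (f ∘ g) xs
  sumL-map f g []       = refl
  sumL-map f g (x ∷ xs) = cong (f (g x) +_) (sumL-map f g xs)

  sumL-concatMap : ∀ {A B C : Set} (f : C → ℕ) (g : A → B → C) (ys : List B) xs →
    sumL f (concatMap (λ x → List.map (g x) ys) xs) ≡ sumL (λ x → sumL (f ∘ g x) ys) xs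
  sumL-concatMap f g ys []       = refl
  sumL-concatMap f g ys (x ∷ xs) = trans (sumL-++ f (List.map (g x) ys) _)
    (cong₂ _+_ (sumL-map f (g x) ys) (sumL-concatMap f g ys xs))

  sumL-cong : ∀ {A : Set} {f g : A → ℕ} xs → (∀ x → f x ≡ g x) → sumL f xs ≡ sumL g xs
  sumL-cong []       eq = refl
  sumL-cong (x ∷ xs) eq = cong₂ _+_ (eq x) (sumL-cong xs eq)

  sumL-mono : ∀ {A : Set} {f g : A → ℕ} xs → (∀ x → f x ≤ g x) → sumL f xs ≤ sumL g xs
  sumL-mono []       le = z≤n
  sumL-mono (x ∷ xs) le = +-mono-≤ (le x) (sumL-mono xs le)

  sumL-+ : ∀ {A : Set} (f g : A → ℕ) xs → sumL (λ x → f x + g x) xs ≡ sumL f xs + sumL g xs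
  sumL-+ f g []       = refl
  sumL-+ f g (x ∷ xs) = trans (cong (f x + g x +_) (sumL-+ f g xs)) (interchange (f x) (g x) _ _)
    where
    interchange : ∀ a b c d → a + b + (c + d) ≡ a + c + (b + d)
    interchange = solve-∀

  sumL-*ˡ : ∀ {A : Set} c (f : A → ℕ) xs → sumL (λ x → c * f x) xs ≡ c * sumL f xs
  sumL-*ˡ c f []       = sym (*-zeroʳ c)
  sumL-*ˡ c f (x ∷ xs) = trans (cong (c * f x +_) (sumL-*ˡ c f xs)) (sym (*-distribˡ-+ c (f x) _))

  sumL-const : ∀ {A : Set} c (xs : List A) → sumL (λ _ → c) xs ≡ length xs * c
  sumL-const c []       = refl
  sumL-const c (x ∷ xs) = cong (c +_) (sumL-const c xs)

  length≡sumL : ∀ {A : Set} (xs : List A) → length xs ≡ sumL (λ _ → 1) xs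
  length≡sumL xs = trans (sym (*-identityʳ _)) (sym (sumL-const 1 xs))

  -- Graphs with probes and the sets that they cut out.

  data Trace (V P : Set) : Set where
    nbr   : V → Trace V P
    probe : P → Trace V P

  -- Neighbourhoods and probes are treated together because Burling's step mixes them: the
  -- neighbourhood of `diag p q` within the copy at `p` is the probe `q`.
  Contains : ∀ {V P : Set} → (V → V → Set) → (V → P → Set) → Trace V P → V → Set
  Contains Adj In (nbr u)   v = Adj u v
  Contains Adj In (probe p) v = In v p

  Cuts : ∀ {m} {T : Set} → (T → Fin m → Set) → (Fin m → Bool) → T → Set
  Cuts I B t = ∀ x → (B x ≡ true → I t x) × (B x ≡ false → ¬ I t x)

  -- The full set is exempt because in a join all vertices of other parts realise it. The empty set
  -- is exempt because a trace that misses all points need not restrict to a trace of the smaller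
  -- graph.
  AllProperCuts : ∀ {m} {T : Set} → (T → Fin m → Set) → Set
  AllProperCuts I = ∀ B i j → B i ≡ true → B j ≡ false → ∃ (Cuts I B)

  -- Probes are stable sets ordered by `rank`. By `interval` every neighbourhood meets a probe in
  -- consecutive vertices; `prefix` and `interval` together make the traces through a new diagonal
  -- vertex behave like intervals of a chain. Bounding an independent set by the probes it hits,
  -- rather than by a fraction of the weight, is what the induction can carry.
  record ProbeGraph (k : ℕ) : Set₁ where
    field
      V P      : Set
      _≟V_     : (u v : V) → Dec (u ≡ v)
      _≟P_     : (p q : P) → Dec (p ≡ q)
      Adj      : V → V → Set
      Adj?     : ∀ u v → Dec (Adj u v)
      In       : V → P → Set
      In?      : ∀ v p → Dec (In v p)
      Adj-sym  : ∀ {u v} → Adj u v → Adj v u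
      Adj-irr  : ∀ {u} → ¬ Adj u u
      triangle-free : ∀ {u v w} → Adj u v → Adj v w → ¬ Adj u w
      stable   : ∀ {u v p} → In u p → In v p → ¬ Adj u v
      rank     : V → ℕ
      height   : ℕ
      rank<    : ∀ v → rank v < height
      -- by prefix, the sets of probes through a vertex form a laminar family
      prefix   : ∀ {u w p q} → In u p → In w p → rank u ≤ rank w → In w q → In u q
      interval : ∀ {u v w p} → In u p → In v p → In w p → rank u ≤ rank v → rank v ≤ rank w →
        ∀ y → Adj y u → Adj y w → Adj y v
      no-shattering : (f : Fin 4 → V) → ¬ AllProperCuts (λ t x → Contains Adj In t (f x))
      vertices : List V
      probes   : List P
      hit      : (V → Bool) → P → Bool
      hit-sound : ∀ I p → hit I p ≡ true → ∃ λ v → In v p × I v ≡ true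
      -- By ratio, an independent set has at most the fraction 2/(2+k) of the weight,
      -- where multiplicities in the list of vertices serve as weights.
      weight≤hits : ∀ I → (∀ u v → I u ≡ true → I v ≡ true → ¬ Adj u v) →
        sumL (λ v → ⟦ I v ⟧) vertices ≤ sumL (λ p → ⟦ hit I p ⟧) probes
      ratio    : 2 * length vertices ≡ (2 + k) * length probes
      probes>0 : 0 < length probes

  -- Three convex subsets of a chain never cut each other in all possible ways: the
  -- private points of the three sets are ordered, and the set whose private point is
  -- in the middle cannot be avoided by a common point of the outer two.
  three-convex : ∀ {C : Set} (ρ : C → ℕ) (I : C → Fin 3 → Set) →
    (∀ j {a b c} → ρ a ≤ ρ b → ρ b ≤ ρ c → I a j → I c j → I b j) →
    ¬ AllProperCuts I
  three-convex {C} ρ I convex cuts = sorted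
    where
    only except : Fin 3 → Fin 3 → Bool
    only a x   = ⌊ x Fin.≟ a ⌋
    except b x = not ⌊ x Fin.≟ b ⌋
    other : Fin 3 → Fin 3
    other zero    = suc zero
    other (suc _) = zero
    other≢ : ∀ a → other a ≢ a
    other≢ zero    ()
    other≢ (suc _) ()
    private′ : ∀ a → ∃ (Cuts I (only a))
    private′ a = cuts (only a) a (other a) (⌊⌋-true (a Fin.≟ a) refl) (⌊⌋-false (other a Fin.≟ a) (other≢ a))
    shared : ∀ b → ∃ (Cuts I (except b))
    shared b = cuts (except b) (other b) b (cong not (⌊⌋-false (other b Fin.≟ b) (other≢ b))) (cong not (⌊⌋-true (b Fin.≟ b) refl))
    pt : Fin 3 → C
    pt a = proj₁ (private′ a)
    own : ∀ a → I (pt a) a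
    own a = proj₁ (proj₂ (private′ a) a) (⌊⌋-true (a Fin.≟ a) refl)
    foreign : ∀ {a b} → b ≢ a → ¬ I (pt a) b
    foreign {a} {b} ne = proj₂ (proj₂ (private′ a) b) (⌊⌋-false (b Fin.≟ a) ne)
    shared-by : ∀ {a b} → a ≢ b → I (proj₁ (shared b)) a
    shared-by {a} {b} ne = proj₁ (proj₂ (shared b) a) (cong not (⌊⌋-false (a Fin.≟ b) ne))
    middle : ∀ {a b c} → a ≢ b → c ≢ b → ρ (pt a) ≤ ρ (pt b) → ρ (pt b) ≤ ρ (pt c) → ⊥
    middle {a} {b} {c} a≢b c≢b ab bc with ≤-total (ρ (proj₁ (shared b))) (ρ (pt b))
    ... | inj₁ le = foreign c≢b (convex c le bc (shared-by c≢b) (own c))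
    ... | inj₂ ge = foreign a≢b (convex a ab ge (own a) (shared-by a≢b))
    sorted : ⊥
    sorted with ≤-total (ρ (pt zero)) (ρ (pt (suc zero)))
              | ≤-total (ρ (pt (suc zero))) (ρ (pt (suc (suc zero))))
              | ≤-total (ρ (pt zero)) (ρ (pt (suc (suc zero))))
    ... | inj₁ 01≤ | inj₁ 12≤ | _        = middle {zero} {suc zero} {suc (suc zero)} (λ ()) (λ ()) 01≤ 12≤
    ... | inj₁ 01≤ | inj₂ 21≤ | inj₁ 02≤ = middle {zero} {suc (suc zero)} {suc zero} (λ ()) (λ ()) 02≤ 21≤
    ... | inj₁ 01≤ | inj₂ 21≤ | inj₂ 20≤ = middle {suc (suc zero)} {zero} {suc zero} (λ ()) (λ ()) 20≤ 01≤
    ... | inj₂ 10≤ | inj₁ 12≤ | inj₁ 02≤ = middle {suc zero} {zero} {suc (suc zero)} (λ ()) (λ ()) 10≤ 02≤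
    ... | inj₂ 10≤ | inj₁ 12≤ | inj₂ 20≤ = middle {suc zero} {suc (suc zero)} {zero} (λ ()) (λ ()) 12≤ 20≤
    ... | inj₂ 10≤ | inj₂ 21≤ | _        = middle {suc (suc zero)} {suc zero} {zero} (λ ()) (λ ()) 21≤ 10≤

  two-others : ∀ (i j : Fin 4) → ∃ λ k → ∃ λ l → (k ≢ i × k ≢ j) × (l ≢ i × l ≢ j) × k ≢ l
  two-others = toWitness {a? = Fin.all? λ i → Fin.all? λ j → Fin.any? λ k → Fin.any? λ l →
    (¬? (k Fin.≟ i) ×-dec ¬? (k Fin.≟ j)) ×-dec ((¬? (l Fin.≟ i) ×-dec ¬? (l Fin.≟ j)) ×-dec ¬? (k Fin.≟ l))} tt

  -- Burling's step: each probe p of the base graph receives its own copy, and each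
  -- probe q of that copy receives a new vertex diag p q, adjacent to the vertices of q.
  data Vertex (V P : Set) : Set where
    base : V → Vertex V P
    copy : P → V → Vertex V P
    diag : P → P → Vertex V P

  -- union p q is p together with the copy of q at p; extend p q is p together with diag p q.
  data Probe (P : Set) : Set where
    union extend : P → P → Probe P

  -- Burling's step preserves the invariants.

  module Step {k : ℕ} (B : ProbeGraph k) where
    open ProbeGraph B

    V⁺ P⁺ : Set
    V⁺ = Vertex V P
    P⁺ = Probe P

    _≟V⁺_ : (u v : V⁺) → Dec (u ≡ v)
    base u   ≟V⁺ base v   = map′ (cong base) (λ { refl → refl }) (u ≟V v)
    copy p u ≟V⁺ copy q v = map′ (λ { (refl , refl) → refl }) (λ { refl → refl , refl }) (p ≟P q ×-dec u ≟V v)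
    diag p q ≟V⁺ diag r s = map′ (λ { (refl , refl) → refl }) (λ { refl → refl , refl }) (p ≟P r ×-dec q ≟P s)
    base _   ≟V⁺ copy _ _ = no λ ()
    base _   ≟V⁺ diag _ _ = no λ ()
    copy _ _ ≟V⁺ base _   = no λ ()
    copy _ _ ≟V⁺ diag _ _ = no λ ()
    diag _ _ ≟V⁺ base _   = no λ ()
    diag _ _ ≟V⁺ copy _ _ = no λ ()

    _≟P⁺_ : (p q : P⁺) → Dec (p ≡ q)
    union p q  ≟P⁺ union r s  = map′ (λ { (refl , refl) → refl }) (λ { refl → refl , refl }) (p ≟P r ×-dec q ≟P s)
    extend p q ≟P⁺ extend r s = map′ (λ { (refl , refl) → refl }) (λ { refl → refl , refl }) (p ≟P r ×-dec q ≟P s)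
    union _ _  ≟P⁺ extend _ _ = no λ ()
    extend _ _ ≟P⁺ union _ _  = no λ ()

    Adj⁺ : V⁺ → V⁺ → Set
    Adj⁺ (base u)   (base v)   = Adj u v
    Adj⁺ (copy p u) (copy q v) = p ≡ q × Adj u v
    Adj⁺ (copy p u) (diag q r) = p ≡ q × In u r
    Adj⁺ (diag q r) (copy p u) = p ≡ q × In u r
    Adj⁺ _          _          = ⊥

    In⁺ : V⁺ → P⁺ → Set
    In⁺ (base v)   (union p q)  = In v p
    In⁺ (base v)   (extend p q) = In v p
    In⁺ (copy r v) (union p q)  = r ≡ p × In v q
    In⁺ (diag r s) (extend p q) = r ≡ p × s ≡ q
    In⁺ _          _            = ⊥

    Adj⁺? : ∀ u v → Dec (Adj⁺ u v)
    Adj⁺? (base u)   (base v)   = Adj? u v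
    Adj⁺? (base u)   (copy _ _) = no λ ()
    Adj⁺? (base u)   (diag _ _) = no λ ()
    Adj⁺? (copy p u) (base v)   = no λ ()
    Adj⁺? (copy p u) (copy q v) = p ≟P q ×-dec Adj? u v
    Adj⁺? (copy p u) (diag q r) = p ≟P q ×-dec In? u r
    Adj⁺? (diag q r) (base v)   = no λ ()
    Adj⁺? (diag q r) (copy p u) = p ≟P q ×-dec In? u r
    Adj⁺? (diag q r) (diag _ _) = no λ ()

    In⁺? : ∀ v p → Dec (In⁺ v p)
    In⁺? (base v)   (union p q)  = In? v p
    In⁺? (base v)   (extend p q) = In? v p
    In⁺? (copy r v) (union p q)  = r ≟P p ×-dec In? v q
    In⁺? (copy r v) (extend p q) = no λ ()
    In⁺? (diag r s) (union p q)  = no λ ()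
    In⁺? (diag r s) (extend p q) = r ≟P p ×-dec s ≟P q

    Adj⁺-sym : ∀ {u v} → Adj⁺ u v → Adj⁺ v u
    Adj⁺-sym {base u}   {base v}   a          = Adj-sym a
    Adj⁺-sym {copy p u} {copy q v} (refl , a) = refl , Adj-sym a
    Adj⁺-sym {copy p u} {diag q r} a          = a
    Adj⁺-sym {diag q r} {copy p u} a          = a

    Adj⁺-irr : ∀ {u} → ¬ Adj⁺ u u
    Adj⁺-irr {base u}   a       = Adj-irr a
    Adj⁺-irr {copy p u} (_ , a) = Adj-irr a

    triangle-free⁺ : ∀ {u v w} → Adj⁺ u v → Adj⁺ v w → ¬ Adj⁺ u w
    triangle-free⁺ {base u}   {base v}   {base w}   a       b       c       = triangle-free a b c
    triangle-free⁺ {copy p u} {copy q v} {copy r w} (_ , a) (_ , b) (_ , c) = triangle-free a b c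
    triangle-free⁺ {copy p u} {copy q v} {diag r s} (_ , a) (_ , b) (_ , c) = stable c b a
    triangle-free⁺ {copy p u} {diag q s} {copy r w} (_ , a) (_ , b) (_ , c) = stable a b c
    triangle-free⁺ {diag p s} {copy q v} {copy r w} (_ , a) (_ , b) (_ , c) = stable a c b

    stable⁺ : ∀ {u v p} → In⁺ u p → In⁺ v p → ¬ Adj⁺ u v
    stable⁺ {base u}   {base v}   {union p q}  a       b       c       = stable a b c
    stable⁺ {base u}   {base v}   {extend p q} a       b       c       = stable a b c
    stable⁺ {copy r u} {copy s v} {union p q}  (_ , a) (_ , b) (_ , c) = stable a b c
    stable⁺ {base u}   {diag r s} {extend p q} _       _       ()
    stable⁺ {copy r u} {diag _ _} {extend p q} ()
    stable⁺ {diag _ _} {diag r s} {extend p q} _       _       ()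

    -- New vertices rank above the whole base graph, so every new probe lists the vertices of `p`
    -- before those of the copied `q` or the diagonal vertex.
    rank⁺ : V⁺ → ℕ
    rank⁺ (base v)   = rank v
    rank⁺ (copy p v) = height + rank v
    rank⁺ (diag p q) = height

    height⁺ : ℕ
    height⁺ = suc (height + height)

    rank⁺< : ∀ v → rank⁺ v < height⁺
    rank⁺< (base v)   = s≤s (≤-trans (<⇒≤ (rank< v)) (m≤m+n height height))
    rank⁺< (copy p v) = s≤s (+-monoʳ-≤ height (<⇒≤ (rank< v)))
    rank⁺< (diag p q) = s≤s (m≤m+n height height)

    above-base : ∀ {v n} → height + n ≤ rank v → ⊥
    above-base {v} le = <⇒≱ (rank< v) (≤-trans (m≤m+n height _) le)

    above-base′ : ∀ {v} → height ≤ rank v → ⊥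
    above-base′ {v} = <⇒≱ (rank< v)

    -- A copy or diagonal vertex fixes the first index of every probe through it, so the base
    -- vertices below it come along; within one copy the old property applies.
    prefix⁺ : ∀ {u w p q} → In⁺ u p → In⁺ w p → rank⁺ u ≤ rank⁺ w → In⁺ w q → In⁺ u q
    prefix⁺ {base u}   {base w}   {union _ _}  {union _ _}  a b le c = prefix a b le c
    prefix⁺ {base u}   {base w}   {union _ _}  {extend _ _} a b le c = prefix a b le c
    prefix⁺ {base u}   {base w}   {extend _ _} {union _ _}  a b le c = prefix a b le c
    prefix⁺ {base u}   {base w}   {extend _ _} {extend _ _} a b le c = prefix a b le c
    prefix⁺ {base u}   {copy _ w} {union _ _}  {union _ _}  a (refl , b) le (refl , c) = a
    prefix⁺ {base u}   {diag _ _} {extend _ _} {extend _ _} a (refl , refl) le (refl , refl) = a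
    prefix⁺ {copy _ u} {base w}   {union _ _}  a b le c = ⊥-elim (above-base le)
    prefix⁺ {copy _ u} {copy _ w} {union _ _}  {union _ _}  (refl , a) (refl , b) le (refl , c) =
      refl , prefix a b (+-cancelˡ-≤ height _ _ le) c
    prefix⁺ {diag _ _} {base w}   {extend _ _} a b le c = ⊥-elim (above-base′ le)
    prefix⁺ {diag _ _} {diag _ _} {extend _ _} {extend _ _} (refl , refl) (refl , refl) le (refl , refl) = refl , refl

    -- No vertex has neighbours both in the base and in a copy, so the rank order confines the three
    -- points to one side. If `y` is diagonal, its neighbours in the copy form a probe and `prefix`
    -- takes the place of `interval`.
    interval⁺ : ∀ {u v w p} → In⁺ u p → In⁺ v p → In⁺ w p → rank⁺ u ≤ rank⁺ v → rank⁺ v ≤ rank⁺ w →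
      ∀ y → Adj⁺ y u → Adj⁺ y w → Adj⁺ y v
    interval⁺ {base u} {base v}   {base w} {union _ _}  a b c uv vw (base y) yu yw = interval a b c uv vw y yu yw
    interval⁺ {base u} {base v}   {base w} {extend _ _} a b c uv vw (base y) yu yw = interval a b c uv vw y yu yw
    interval⁺ {base u} {copy _ v} {base w} {union _ _}  a b c uv vw (base y) yu yw = ⊥-elim (above-base vw)
    interval⁺ {base u} {diag _ _} {base w} {extend _ _} a b c uv vw (base y) yu yw = ⊥-elim (above-base′ vw)
    interval⁺ {copy _ u} {base v} {p = union _ _} a b c uv vw y yu yw = ⊥-elim (above-base uv)
    interval⁺ {copy _ u} {copy _ v} {copy _ w} {union _ _} (refl , a) (refl , b) (refl , c) uv vw (copy _ y) (refl , yu) (_ , yw) =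
      refl , interval a b c (+-cancelˡ-≤ height _ _ uv) (+-cancelˡ-≤ height _ _ vw) y yu yw
    interval⁺ {copy _ u} {copy _ v} {copy _ w} {union _ _} (refl , a) (refl , b) (refl , c) uv vw (diag _ _) (refl , yu) (_ , yw) =
      refl , prefix b c (+-cancelˡ-≤ height _ _ vw) yw
    interval⁺ {diag _ _} {base v} {p = extend _ _} a b c uv vw y yu yw = ⊥-elim (above-base′ uv)
    interval⁺ {diag _ _} {diag _ _} {p = extend _ _} (refl , refl) (refl , refl) c uv vw y yu yw = yu

    T⁺ : Set
    T⁺ = Trace V⁺ P⁺

    _∋_ : Trace V P → V → Set
    _∋_ = Contains Adj In

    _∋⁺_ : T⁺ → V⁺ → Set
    _∋⁺_ = Contains Adj⁺ In⁺

    traceRank : T⁺ → ℕ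
    traceRank (nbr (copy _ u)) = rank u
    traceRank _                = height

    -- The traces through diag p q are the chain q of neighbours, followed by extend p q.
    chain-convex : ∀ {p q t₁ t₂ t₃} → t₁ ∋⁺ diag p q → t₂ ∋⁺ diag p q → t₃ ∋⁺ diag p q →
      traceRank t₁ ≤ traceRank t₂ → traceRank t₂ ≤ traceRank t₃ → ∀ y → t₁ ∋⁺ y → t₃ ∋⁺ y → t₂ ∋⁺ y
    chain-convex {t₁ = nbr (copy _ u)} {nbr (copy _ v)} {nbr (copy _ w)} (refl , a) (refl , b) (refl , c) uv vw (copy _ y) (refl , yu) (_ , yw) =
      refl , Adj-sym (interval a b c uv vw y (Adj-sym yu) (Adj-sym yw))
    chain-convex {t₁ = nbr (copy _ u)} {nbr (copy _ v)} {nbr (copy _ w)} (refl , a) (refl , b) (refl , c) uv vw (diag _ _) (refl , yu) (_ , yw) =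
      refl , prefix b c vw yw
    chain-convex {t₁ = nbr (copy _ u)} {nbr (copy _ v)} {probe (extend _ _)} (refl , a) (refl , b) (refl , refl) uv vw (diag _ _) yu (refl , refl) =
      refl , b
    chain-convex {t₁ = nbr (copy _ u)} {probe (extend _ _)} {nbr (copy _ w)} a b c uv vw y yu yw = ⊥-elim (above-base′ vw)
    chain-convex {t₁ = nbr (copy _ u)} {probe (extend _ _)} {probe (extend _ _)} a (refl , refl) (refl , refl) uv vw y yu yw = yw
    chain-convex {t₁ = probe (extend _ _)} {nbr (copy _ v)} a b c uv vw y yu yw = ⊥-elim (above-base′ uv)
    chain-convex {t₁ = probe (extend _ _)} {probe (extend _ _)} (refl , refl) (refl , refl) c uv vw y yu yw = yu

    base-copy-trace : ∀ {a p b} t → t ∋⁺ base a → t ∋⁺ copy p b → ∃ λ q → t ≡ probe (union p q) × In b q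
    base-copy-trace (nbr (base _))   _ ()
    base-copy-trace (nbr (copy _ _)) ()
    base-copy-trace (nbr (diag _ _)) ()
    base-copy-trace (probe (union p q)) a (refl , b) = q , refl , b

    copies-agree : ∀ {p u q v} t → t ∋⁺ copy p u → t ∋⁺ copy q v → p ≡ q
    copies-agree (nbr (copy _ _))    (refl , _) (refl , _) = refl
    copies-agree (nbr (diag _ _))    (refl , _) (refl , _) = refl
    copies-agree (probe (union _ _)) (refl , _) (refl , _) = refl

    Restricts : (V → V⁺) → T⁺ → Trace V P → Set
    Restricts ι t t′ = ∀ w → (t ∋⁺ ι w → t′ ∋ w) × (t′ ∋ w → t ∋⁺ ι w)

    restrict-base : ∀ {v} t → t ∋⁺ base v → ∃ (Restricts base t)
    restrict-base (nbr (base u))       _ = nbr u   , λ w → id , id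
    restrict-base (probe (union p q))  _ = probe p , λ w → id , id
    restrict-base (probe (extend p q)) _ = probe p , λ w → id , id

    restrict-copy : ∀ {p v} t → t ∋⁺ copy p v → ∃ (Restricts (copy p) t)
    restrict-copy (nbr (copy _ u))    (refl , _) = nbr u   , λ w → proj₂ , (refl ,_)
    restrict-copy (nbr (diag _ q))    (refl , _) = probe q , λ w → proj₂ , (refl ,_)
    restrict-copy (probe (union _ q)) (refl , _) = probe q , λ w → proj₂ , (refl ,_)

    Cuttable : (Fin 4 → V⁺) → Set
    Cuttable f = AllProperCuts (λ t x → t ∋⁺ f x)

    lower : (ι : V → V⁺) → (∀ {v} t → t ∋⁺ ι v → ∃ (Restricts ι t)) →
      ∀ f (f′ : Fin 4 → V) → (∀ x → f x ≡ ι (f′ x)) → ¬ Cuttable f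
    lower ι restrict f f′ eq cuts = no-shattering f′ λ B i j Bi Bj → go B i (cuts B i j Bi Bj) Bi
      where
      go : ∀ B i → ∃ (Cuts (λ t x → t ∋⁺ f x) B) → B i ≡ true → ∃ (Cuts (λ t x → t ∋ f′ x) B)
      go B i (t , cut) Bi with t′ , res ← restrict t (subst (t ∋⁺_) (eq i) (proj₁ (cut i) Bi)) =
        t′ , λ x → (λ Bx → proj₁ (res (f′ x)) (subst (t ∋⁺_) (eq x) (proj₁ (cut x) Bx)))
                 , λ Bx t′∋ → proj₂ (cut x) Bx (subst (t ∋⁺_) (sym (eq x)) (proj₂ (res (f′ x)) t′∋))

    except : Fin 4 → Fin 4 → Bool
    except k x = not ⌊ x Fin.≟ k ⌋

    all-but : ∀ f → Cuttable f → ∀ i k → i ≢ k → ∃ λ t → (∀ x → x ≢ k → t ∋⁺ f x) × ¬ t ∋⁺ f k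
    all-but f cuts i k i≢k
      with t , cut ← cuts (except k) i k (cong not (⌊⌋-false (i Fin.≟ k) i≢k)) (cong not (⌊⌋-true (k Fin.≟ k) refl)) =
      t , (λ x ne → proj₁ (cut x) (cong not (⌊⌋-false (x Fin.≟ k) ne)))
        , proj₂ (cut k) (cong not (⌊⌋-true (k Fin.≟ k) refl))

    -- Adding `i` to every set to be cut leaves only traces through `diag p q`; on that chain the
    -- other three points are convex.
    diag-case : ∀ f {p q} i → f i ≡ diag p q → ¬ Cuttable f
    diag-case f {p} {q} i fi cuts = three-convex {C = Σ T⁺ (_∋⁺ diag p q)} (traceRank ∘ proj₁)
      (λ t j → proj₁ t ∋⁺ f (punchIn i j))
      (λ j {a} {b} {c} ab bc → chain-convex {t₁ = proj₁ a} {proj₁ b} {proj₁ c} (proj₂ a) (proj₂ b) (proj₂ c) ab bc (f (punchIn i j)))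
      λ S x y Sx Sy → go S (cuts (insertAt S i true) i (punchIn i y) (Functional.insertAt-lookup S i true)
        (trans (Functional.insertAt-punchIn S i true y) Sy))
      where
      go : ∀ S → ∃ (Cuts (λ t x → t ∋⁺ f x) (insertAt S i true)) →
        ∃ (Cuts (λ (t : Σ T⁺ (_∋⁺ diag p q)) j → proj₁ t ∋⁺ f (punchIn i j)) S)
      go S (t , cut) = (t , subst (t ∋⁺_) fi (proj₁ (cut i) (Functional.insertAt-lookup S i true))) ,
        λ x → (λ Sx → proj₁ (cut (punchIn i x)) (trans (Functional.insertAt-punchIn S i true x) Sx))
            , λ Sx → proj₂ (cut (punchIn i x)) (trans (Functional.insertAt-punchIn S i true x) Sx)

    -- The traces `t₁` and `t₂` are union probes with the same first index, so they agree on the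
    -- base, and `v` and `w`, on which they differ, must be copies at `p`. Then `t₃` is a union
    -- probe as well, and laminarity decides: if `b` precedes `v`, then `t₃` contains `copy p b`;
    -- otherwise `t₂` contains `v`.
    mixed-triple : ∀ {a p b} v w → (∀ r s → v ≢ diag r s) → (∀ r s → w ≢ diag r s) → ∀ t₁ t₂ t₃ →
      (t₁ ∋⁺ base a × t₁ ∋⁺ copy p b) × t₁ ∋⁺ v × ¬ t₁ ∋⁺ w →
      (t₂ ∋⁺ base a × t₂ ∋⁺ copy p b) × ¬ t₂ ∋⁺ v × t₂ ∋⁺ w →
      t₃ ∋⁺ base a × ¬ t₃ ∋⁺ copy p b × t₃ ∋⁺ v × t₃ ∋⁺ w → ⊥
    mixed-triple v w v≢ w≢ t₁ t₂ t₃ ((a₁ , b₁) , v₁ , ¬w₁) ((a₂ , b₂) , ¬v₂ , w₂) (a₃ , ¬b₃ , v₃ , w₃)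
      with q₁ , refl , b∈q₁ ← base-copy-trace t₁ a₁ b₁
      with q₂ , refl , b∈q₂ ← base-copy-trace t₂ a₂ b₂ = go v w v≢ w≢ v₁ ¬w₁ ¬v₂ w₂ v₃
      where
      go : ∀ v w → (∀ r s → v ≢ diag r s) → (∀ r s → w ≢ diag r s) →
        In⁺ v (union _ q₁) → ¬ In⁺ w (union _ q₁) → ¬ In⁺ v (union _ q₂) → In⁺ w (union _ q₂) → t₃ ∋⁺ v → ⊥
      go (diag r s) _          v≢ _  = λ _ _ _ _ _ → v≢ r s refl
      go (base _)   _          _  _  v₁ _ ¬v₂ _ _ = ¬v₂ v₁
      go (copy _ _) (diag r s) _  w≢ = λ _ _ _ _ _ → w≢ r s refl
      go (copy _ _) (base _)   _  _  _ ¬w₁ _ w₂ _ = ¬w₁ w₂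
      go (copy _ c) (copy _ e) _  _  (refl , c∈q₁) _ ¬v₂ _ v₃
        with q₃ , refl , c∈q₃ ← base-copy-trace t₃ a₃ v₃
        with ≤-total (rank _) (rank c)
      ... | inj₁ b≤c = ¬b₃ (refl , prefix b∈q₁ c∈q₁ b≤c c∈q₃)
      ... | inj₂ c≤b = ¬v₂ (refl , prefix c∈q₁ b∈q₁ c≤b b∈q₂)

    mixed-case : ∀ f {a p b} i j → f i ≡ base a → f j ≡ copy p b → (∀ x r s → f x ≢ diag r s) → ¬ Cuttable f
    mixed-case f i j fi fj no-diag cuts
      with k , l , (k≢i , k≢j) , (l≢i , l≢j) , k≢l ← two-others i j
      with t₁ , t₁∋ , t₁∌ ← all-but f cuts i l (l≢i ∘ sym)
      with t₂ , t₂∋ , t₂∌ ← all-but f cuts i k (k≢i ∘ sym)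
      with t₃ , t₃∋ , t₃∌ ← all-but f cuts k j k≢j =
      mixed-triple (f k) (f l) (no-diag k) (no-diag l) t₁ t₂ t₃
        ((at t₁ fi (t₁∋ i (l≢i ∘ sym)) , at t₁ fj (t₁∋ j (l≢j ∘ sym))) , t₁∋ k k≢l , t₁∌)
        ((at t₂ fi (t₂∋ i (k≢i ∘ sym)) , at t₂ fj (t₂∋ j (k≢j ∘ sym))) , t₂∌ , t₂∋ l (k≢l ∘ sym))
        (at t₃ fi (t₃∋ i i≢j) , (λ t∋ → t₃∌ (subst (t₃ ∋⁺_) (sym fj) t∋)) , t₃∋ k k≢j , t₃∋ l l≢j)
      where
      at : ∀ t {x v} → f x ≡ v → t ∋⁺ f x → t ∋⁺ v
      at t = subst (t ∋⁺_)
      i≢j : i ≢ j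
      i≢j refl = contradiction (trans (sym fi) fj) λ ()

    -- The kinds of the four points decide: a diagonal vertex gives a chain, base and copy vertices
    -- together contradict laminarity, and points of one kind reduce to the smaller graph.
    no-shattering⁺ : (f : Fin 4 → V⁺) → ¬ Cuttable f
    no-shattering⁺ f cuts with Fin.any? (λ i → diag? (f i))
      where
      diag? : ∀ v → Dec (∃ λ p → ∃ λ q → v ≡ diag p q)
      diag? (base _)   = no λ ()
      diag? (copy _ _) = no λ ()
      diag? (diag p q) = yes (p , q , refl)
    ... | yes (i , p , q , fi) = diag-case f i fi cuts
    ... | no no-diag with Fin.any? (λ i → base? (f i)) | Fin.any? (λ i → copy? (f i))
      where
      base? : ∀ v → Dec (∃ λ u → v ≡ base u)
      base? (base u)   = yes (u , refl)
      base? (copy _ _) = no λ ()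
      base? (diag _ _) = no λ ()
      copy? : ∀ v → Dec (∃ λ p → ∃ λ u → v ≡ copy p u)
      copy? (base _)   = no λ ()
      copy? (copy p u) = yes (p , u , refl)
      copy? (diag _ _) = no λ ()
    ...   | yes (i , a , fi) | yes (j , p , b , fj) = mixed-case f i j fi fj (λ x r s fx → no-diag (x , r , s , fx)) cuts
    ...   | _ | no no-copy = lower base restrict-base f (λ x → proj₁ (all-base x)) (λ x → proj₂ (all-base x)) cuts
      where
      all-base : ∀ x → ∃ λ u → f x ≡ base u
      all-base x with f x in fx
      ... | base u   = u , refl
      ... | copy p u = contradiction (x , p , u , fx) no-copy
      ... | diag p q = contradiction (x , p , q , fx) no-diag
    ...   | no no-base | yes (j , p , b , fj) = lower (copy p) restrict-copy f (λ x → proj₁ (all-copy x)) (λ x → proj₂ (all-copy x)) cuts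
      where
      all-copy : ∀ x → ∃ λ u → f x ≡ copy p u
      -- A trace that avoids only a third point `k` contains both `f x` and `f j`, which forces them
      -- into the same copy.
      all-copy x with k , _ , (k≢x , k≢j) , _ ← two-others x j
                 with t , t∋ , _ ← all-but f cuts x k (k≢x ∘ sym)
                 with f x in fx | t∋ x (k≢x ∘ sym)
      ... | base u   | _  = contradiction (x , u , fx) no-base
      ... | diag r s | _  = contradiction (x , r , s , fx) no-diag
      ... | copy r u | fx∈ = u , cong (λ q → copy q u) (copies-agree t fx∈ (subst (t ∋⁺_) fj (t∋ j (k≢j ∘ sym))))

    -- Base vertices are repeated once for each probe, so that a base probe that is hit accounts for
    -- one unit in every pair `(p , q)`.
    vertices⁺ : List V⁺
    vertices⁺ = concatMap (λ _ → List.map base vertices) probes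
      ++ (concatMap (λ p → List.map (copy p) vertices) probes
      ++ concatMap (λ p → List.map (diag p) probes) probes)

    probes⁺ : List P⁺
    probes⁺ = concatMap (λ p → List.map (union p) probes) probes ++ concatMap (λ p → List.map (extend p) probes) probes

    hit⁺ : (V⁺ → Bool) → P⁺ → Bool
    hit⁺ I (union p q)  = hit (I ∘ base) p ∨ hit (I ∘ copy p) q
    hit⁺ I (extend p q) = hit (I ∘ base) p ∨ I (diag p q)

    hit⁺-sound : ∀ I p → hit⁺ I p ≡ true → ∃ λ v → In⁺ v p × I v ≡ true
    hit⁺-sound I (union p q) h with hit (I ∘ base) p in eq
    ... | true  with v , a , b ← hit-sound (I ∘ base) p eq = base v , a , b
    ... | false with v , a , b ← hit-sound (I ∘ copy p) q h = copy p v , (refl , a) , b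
    hit⁺-sound I (extend p q) h with hit (I ∘ base) p in eq
    ... | true  with v , a , b ← hit-sound (I ∘ base) p eq = base v , a , b
    ... | false = diag p q , (refl , refl) , h

    M W : ℕ
    M = length probes
    W = length vertices

    sum-vertices⁺ : ∀ f → sumL f vertices⁺ ≡
      M * sumL (f ∘ base) vertices + (sumL (λ p → sumL (f ∘ copy p) vertices) probes + sumL (λ p → sumL (f ∘ diag p) probes) probes)
    sum-vertices⁺ f = trans (sumL-++ f (concatMap (λ _ → List.map base vertices) probes) _) (cong₂ _+_
      (trans (sumL-concatMap f (λ _ → base) vertices probes) (sumL-const _ probes))
      (trans (sumL-++ f (concatMap (λ p → List.map (copy p) vertices) probes) _) (cong₂ _+_
        (sumL-concatMap f copy vertices probes) (sumL-concatMap f diag probes probes))))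

    sum-probes⁺ : ∀ f → sumL f probes⁺ ≡ sumL (λ p → sumL (f ∘ union p) probes) probes + sumL (λ p → sumL (f ∘ extend p) probes) probes
    sum-probes⁺ f = trans (sumL-++ f (concatMap (λ p → List.map (union p) probes) probes) _)
      (cong₂ _+_ (sumL-concatMap f union probes probes) (sumL-concatMap f extend probes probes))

    -- The inequality holds for each pair `(p , q)`. As `diag p q` is adjacent to all of the copied
    -- `q`, it cannot lie in `I` when `I` hits that copy; so the copy and the diagonal vertex
    -- contribute at most 1, and a hit of `p` pays for both new probes.
    weight≤hits⁺ : ∀ I → (∀ u v → I u ≡ true → I v ≡ true → ¬ Adj⁺ u v) →
      sumL (λ v → ⟦ I v ⟧) vertices⁺ ≤ sumL (λ p → ⟦ hit⁺ I p ⟧) probes⁺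
    weight≤hits⁺ I indep = begin
      sumL (λ v → ⟦ I v ⟧) vertices⁺
        ≡⟨ sum-vertices⁺ _ ⟩
      M * sumL (λ v → ⟦ I (base v) ⟧) vertices + (sumL (λ p → sumL (λ v → ⟦ I (copy p v) ⟧) vertices) probes + D)
        ≤⟨ +-mono-≤ (*-monoʳ-≤ M (weight≤hits (I ∘ base) λ u v → indep (base u) (base v)))
             (+-monoˡ-≤ D (sumL-mono probes λ p → weight≤hits (I ∘ copy p)
               λ u v Iu Iv uv → indep (copy p u) (copy p v) Iu Iv (refl , uv))) ⟩
      M * sumL (λ p → ⟦ h p ⟧) probes + (sumL (λ p → sumL (λ q → ⟦ h′ p q ⟧) probes) probes + D)
        ≡⟨ cong (_+ (sumL (λ p → sumL (λ q → ⟦ h′ p q ⟧) probes) probes + D))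
             (sym (trans (sumL-cong probes λ p → sumL-const ⟦ h p ⟧ probes) (sumL-*ˡ M _ probes))) ⟩
      sumL (λ p → sumL (λ q → ⟦ h p ⟧) probes) probes + (sumL (λ p → sumL (λ q → ⟦ h′ p q ⟧) probes) probes + D)
        ≡⟨ sym (trans (double (λ p q → ⟦ h p ⟧) (λ p q → ⟦ h′ p q ⟧ + ⟦ I (diag p q) ⟧)) (cong (sumL (λ p → sumL (λ q → ⟦ h p ⟧) probes) probes +_) (double (λ p q → ⟦ h′ p q ⟧) (λ p q → ⟦ I (diag p q) ⟧)))) ⟩
      sumL (λ p → sumL (λ q → ⟦ h p ⟧ + (⟦ h′ p q ⟧ + ⟦ I (diag p q) ⟧)) probes) probes
        ≤⟨ sumL-mono probes (λ p → sumL-mono probes λ q → pointwise (h p) (h′ p q) (I (diag p q)) (exclusive p q)) ⟩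
      sumL (λ p → sumL (λ q → ⟦ h p ∨ h′ p q ⟧ + ⟦ h p ∨ I (diag p q) ⟧) probes) probes
        ≡⟨ double (λ p q → ⟦ h p ∨ h′ p q ⟧) (λ p q → ⟦ h p ∨ I (diag p q) ⟧) ⟩
      sumL (λ p → sumL (λ q → ⟦ h p ∨ h′ p q ⟧) probes) probes + sumL (λ p → sumL (λ q → ⟦ h p ∨ I (diag p q) ⟧) probes) probes
        ≡⟨ sym (sum-probes⁺ _) ⟩
      sumL (λ p → ⟦ hit⁺ I p ⟧) probes⁺ ∎
      where
      open ≤-Reasoning
      h : P → Bool
      h = hit (I ∘ base)
      h′ : P → P → Bool
      h′ p = hit (I ∘ copy p)
      D : ℕ
      D = sumL (λ p → sumL (λ q → ⟦ I (diag p q) ⟧) probes) probes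
      double : ∀ (f g : P → P → ℕ) → sumL (λ p → sumL (λ q → f p q + g p q) probes) probes ≡
        sumL (λ p → sumL (f p) probes) probes + sumL (λ p → sumL (g p) probes) probes
      double f g = trans (sumL-cong probes λ p → sumL-+ (f p) (g p) probes) (sumL-+ _ _ probes)
      exclusive : ∀ p q → h′ p q ≡ true → I (diag p q) ≢ true
      exclusive p q hp Id with v , v∈q , Iv ← hit-sound (I ∘ copy p) q hp = indep (copy p v) (diag p q) Iv Id (refl , v∈q)
      pointwise : ∀ a b c → (b ≡ true → c ≢ true) → ⟦ a ⟧ + (⟦ b ⟧ + ⟦ c ⟧) ≤ ⟦ a ∨ b ⟧ + ⟦ a ∨ c ⟧
      pointwise true  true  true  ex = contradiction refl (ex refl)
      pointwise true  true  false _  = ≤-refl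
      pointwise true  false true  _  = ≤-refl
      pointwise true  false false _  = s≤s z≤n
      pointwise false b     c     _  = ≤-refl

    length-vertices⁺ : length vertices⁺ ≡ M * W + (M * W + M * M)
    length-vertices⁺ = trans (length≡sumL vertices⁺) (trans (sum-vertices⁺ _) (cong₂ _+_
      (cong (M *_) (sym (length≡sumL vertices))) (cong₂ _+_ (nested vertices) (nested probes))))
      where
      nested : ∀ {A : Set} (xs : List A) → sumL (λ _ → sumL (λ _ → 1) xs) probes ≡ M * length xs
      nested xs = trans (sumL-const _ probes) (cong (M *_) (sym (length≡sumL xs)))

    length-probes⁺ : length probes⁺ ≡ M * M + M * M
    length-probes⁺ = trans (length≡sumL probes⁺) (trans (sum-probes⁺ _) (cong₂ _+_ nested nested))
      where
      nested : sumL (λ _ → sumL (λ _ → 1) probes) probes ≡ M * M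
      nested = trans (sumL-const _ probes) (cong (M *_) (sym (length≡sumL probes)))

    -- The step turns `M` probes and weight `W` into `2 * M * M` probes and weight
    -- `2 * M * W + M * M`, which raises `W / M` by one half.
    ratio⁺ : 2 * length vertices⁺ ≡ (3 + k) * length probes⁺
    ratio⁺ = trans (cong (2 *_) length-vertices⁺) (trans (expand M W) (trans (cong (λ w → 2 * (M * w) + 2 * (M * M)) ratio)
      (trans (collect M k) (cong ((3 + k) *_) (sym length-probes⁺)))))
      where
      expand : ∀ M W → 2 * (M * W + (M * W + M * M)) ≡ 2 * (M * (2 * W)) + 2 * (M * M)
      expand = solve-∀
      collect : ∀ M k → 2 * (M * ((2 + k) * M)) + 2 * (M * M) ≡ (3 + k) * (M * M + M * M)
      collect = solve-∀

    probes⁺>0 : 0 < length probes⁺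
    probes⁺>0 = subst (0 <_) (sym length-probes⁺) (≤-trans (*-mono-< probes>0 probes>0) (m≤m+n (M * M) (M * M)))

    next : ProbeGraph (suc k)
    next = record
      { V = V⁺ ; P = P⁺ ; _≟V_ = _≟V⁺_ ; _≟P_ = _≟P⁺_
      ; Adj = Adj⁺ ; Adj? = Adj⁺? ; In = In⁺ ; In? = In⁺?
      ; Adj-sym = λ {u} {v} → Adj⁺-sym {u} {v} ; Adj-irr = λ {u} → Adj⁺-irr {u}
      ; triangle-free = λ {u} {v} {w} → triangle-free⁺ {u} {v} {w}
      ; stable = λ {u} {v} {p} → stable⁺ {u} {v} {p}
      ; rank = rank⁺ ; height = height⁺ ; rank< = rank⁺<
      ; prefix = λ {u} {w} {p} {q} → prefix⁺ {u} {w} {p} {q}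
      ; interval = λ {u} {v} {w} {p} → interval⁺ {u} {v} {w} {p}
      ; no-shattering = no-shattering⁺
      ; vertices = vertices⁺ ; probes = probes⁺ ; hit = hit⁺ ; hit-sound = hit⁺-sound
      ; weight≤hits = weight≤hits⁺ ; ratio = ratio⁺ ; probes>0 = probes⁺>0
      }

  singleton : ProbeGraph 0
  singleton = record
    { V = ⊤ ; P = ⊤ ; _≟V_ = λ _ _ → yes refl ; _≟P_ = λ _ _ → yes refl
    ; Adj = λ _ _ → ⊥ ; Adj? = λ _ _ → no λ () ; In = λ _ _ → ⊤ ; In? = λ _ _ → yes tt
    ; Adj-sym = λ () ; Adj-irr = λ () ; triangle-free = λ () ; stable = λ _ _ ()
    ; rank = λ _ → 0 ; height = 1 ; rank< = λ _ → s≤s z≤n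
    ; prefix = λ _ _ _ _ → tt ; interval = λ _ _ _ _ _ _ ()
    ; no-shattering = none
    ; vertices = tt ∷ [] ; probes = tt ∷ [] ; hit = λ I _ → I tt ; hit-sound = λ I _ h → tt , tt , h
    ; weight≤hits = λ _ _ → ≤-refl ; ratio = refl ; probes>0 = s≤s z≤n
    }
    where
    none : (f : Fin 4 → ⊤) → ¬ AllProperCuts (λ t x → Contains (λ _ _ → ⊥) (λ _ (_ : ⊤) → ⊤) t (f x))
    none f cuts with cuts (λ { zero → true ; (suc _) → false }) zero (suc zero) refl refl
    ... | nbr _   , cut = proj₁ (cut zero) refl
    ... | probe _ , cut = proj₂ (cut (suc zero)) refl tt

  burling : ∀ k → ProbeGraph k
  burling zero    = singleton
  burling (suc k) = Step.next (burling k)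

  -- The lower bound: joins of blown-up Burling graphs

  sum-prefix : ∀ {a b} (f : ℕ → ℕ) → a ≤ b → sumFin a (f ∘ toℕ) ≤ sumFin b (f ∘ toℕ)
  sum-prefix {a} f a≤b with r , refl ← m≤n⇒∃[o]m+o≡n a≤b = ≤-trans
    (≤-reflexive (sum-cong a λ i → cong f (sym (Fin.toℕ-↑ˡ i r))))
    (≤-trans (m≤m+n _ _) (≤-reflexive (sym (sum-++ a r (f ∘ toℕ)))))

  toℕ-mod : ∀ m .{{_ : NonZero m}} (i : Fin m) → toℕ i mod m ≡ i
  toℕ-mod m i = Fin.toℕ-injective (trans (Fin.toℕ-fromℕ< _) (m<n⇒m%n≡m (Fin.toℕ<n i)))

  mod-periodic : ∀ m .{{_ : NonZero m}} x → (m + x) mod m ≡ x mod m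
  mod-periodic m x = Fin.toℕ-injective (trans (Fin.toℕ-fromℕ< _) (trans (trans (cong (_% m) (+-comm m x)) ([m+n]%n≡m%n x m)) (sym (Fin.toℕ-fromℕ< _))))

  sum-periodic : ∀ m .{{_ : NonZero m}} (h : Fin m → ℕ) q →
    sumFin (q * m) (λ x → h (toℕ x mod m)) ≡ q * sumFin m h
  sum-periodic m h zero    = refl
  sum-periodic m h (suc q) = trans (sum-++ m (q * m) _) (cong₂ _+_
    (sum-cong m λ i → cong h (trans (cong (_mod m) (Fin.toℕ-↑ˡ i (q * m))) (toℕ-mod m i)))
    (trans (sum-cong (q * m) λ j → cong h (trans (cong (_mod m) (Fin.toℕ-↑ʳ m j)) (mod-periodic m (toℕ j))))
           (sum-periodic m h q)))

  /-bounds : ∀ n m .{{_ : NonZero m}} → (n / m) * m ≤ n × n ≤ suc (n / m) * m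
  /-bounds n m = ≤-trans (m≤n+m _ (n % m)) (≤-reflexive (sym (m≡m%n+[m/n]*n n m)))
              , ≤-trans (≤-reflexive (m≡m%n+[m/n]*n n m)) (+-monoˡ-≤ _ (<⇒≤ (m%n<n n m)))

  -- Blow-ups repeat their labels with period `m`; when `m` does not divide `n`, rounding up costs
  -- one additional period.
  sum-residue≤ : ∀ m .{{_ : NonZero m}} (h : Fin m → ℕ) n →
    sumFin n (λ x → h (toℕ x mod m)) ≤ suc (n / m) * sumFin m h
  sum-residue≤ m h n = ≤-trans (sum-prefix (h ∘ (_mod m)) (proj₂ (/-bounds n m))) (≤-reflexive (sum-periodic m h (suc (n / m))))

  sum-residue≥ : ∀ m .{{_ : NonZero m}} (h : Fin m → ℕ) n →
    (n / m) * sumFin m h ≤ sumFin n (λ x → h (toℕ x mod m))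
  sum-residue≥ m h n = ≤-trans (≤-reflexive (sym (sum-periodic m h (n / m)))) (sum-prefix (h ∘ (_mod m)) (proj₁ (/-bounds n m)))

  sum-combine : ∀ s w (f : Fin (s * w) → ℕ) → sumFin (s * w) f ≡ sumFin s (λ i → sumFin w (λ j → f (combine i j)))
  sum-combine zero    w f = refl
  sum-combine (suc s) w f = trans (sum-++ w (s * w) f) (cong (sumFin w (λ j → f (j ↑ˡ (s * w))) +_) (sum-combine s w (f ∘ (w ↑ʳ_))))

  sum-remQuot : ∀ s w (g : Fin s × Fin w → ℕ) →
    sumFin (s * w) (g ∘ remQuot {s} w) ≡ sumFin s (λ i → sumFin w (λ j → g (i , j)))
  sum-remQuot s w g = trans (sum-combine s w _) (sum-cong s λ i → sum-cong w λ j → cong g (Fin.remQuot-combine {s} i j))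

  sum-lookup : ∀ {A : Set} (f : A → ℕ) xs → sumFin (length xs) (f ∘ lookupL xs) ≡ sumL f xs
  sum-lookup f []       = refl
  sum-lookup f (x ∷ xs) = cong (f x +_) (sum-lookup f xs)

  count-≡ : ∀ {s} (c : Fin s) → count (λ i → ⌊ i Fin.≟ c ⌋) ≤ 1
  count-≡ c with f , inj , eq ← enum (λ i → ⌊ i Fin.≟ c ⌋) =
    Fin.injective⇒≤ {f = λ _ → zero {0}} λ {i} {j} _ →
      inj (trans (⌊⌋-sound (f i Fin.≟ c) (eq i)) (sym (⌊⌋-sound (f j Fin.≟ c) (eq j))))

  count-≢ : ∀ {t} (c : Fin (suc t)) → t ≤ count (λ i → not ⌊ i Fin.≟ c ⌋)
  count-≢ {t} c = ≤-pred (≤-trans (≤-reflexive all) (+-monoˡ-≤ _ (count-≡ c)))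
    where
    all : suc t ≡ count (λ i → ⌊ i Fin.≟ c ⌋) + count (λ i → not ⌊ i Fin.≟ c ⌋)
    all = trans (sym (trans (sum-const (suc t) 1) (*-identityʳ _))) (count-split (λ _ → true) (λ i → ⌊ i Fin.≟ c ⌋))

  -- Cliques, shattered sets and independent sets in a join of blow-ups.

  module Join {k s : ℕ} (B : ProbeGraph k) where
    open ProbeGraph B

    joined : Fin s × V → Fin s × V → Bool
    joined (i , v) (j , w) = not ⌊ i Fin.≟ j ⌋ ∨ ⌊ Adj? v w ⌋

    joined-sym : ∀ a b → joined a b ≡ joined b a
    joined-sym (i , v) (j , w) = cong₂ _∨_ (cong not (flip (i Fin.≟ j) (j Fin.≟ i) sym sym)) (flip (Adj? v w) (Adj? w v) Adj-sym Adj-sym)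
      where
      flip : ∀ {X Y : Set} (x : Dec X) (y : Dec Y) → (X → Y) → (Y → X) → ⌊ x ⌋ ≡ ⌊ y ⌋
      flip (yes x) y f g = sym (⌊⌋-true y (f x))
      flip (no ¬x) y f g = sym (⌊⌋-false y (¬x ∘ g))

    joined-irr : ∀ a → joined a a ≡ false
    joined-irr (i , v) = cong₂ _∨_ (cong not (⌊⌋-true (i Fin.≟ i) refl)) (⌊⌋-false (Adj? v v) Adj-irr)

    joined-inside : ∀ {i j v w} → i ≡ j → joined (i , v) (j , w) ≡ ⌊ Adj? v w ⌋
    joined-inside {i} {v = v} {w} refl = cong (λ b → not b ∨ ⌊ Adj? v w ⌋) (⌊⌋-true (i Fin.≟ i) refl)

    joined-false : ∀ {a b} → joined a b ≡ false → proj₁ a ≡ proj₁ b × ¬ Adj (proj₂ a) (proj₂ b)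
    joined-false {i , v} {j , w} eq with i Fin.≟ j | Adj? v w
    ... | yes i≡j | no ¬a = i≡j , ¬a

    joinGraph : ∀ {n} → (Fin n → Fin s × V) → Graph n
    joinGraph ℓ = record
      { adj    = λ x y → joined (ℓ x) (ℓ y)
      ; sym    = λ x y → joined-sym (ℓ x) (ℓ y)
      ; irrefl = λ x → joined-irr (ℓ x)
      }

    -- Clique vertices in one part have pairwise adjacent labels, so triangle-freeness leaves at
    -- most two in each of the `s` parts.
    join-KFree : ∀ {n} (ℓ : Fin n → Fin s × V) → KFree (suc (s * 2)) (joinGraph ℓ)
    join-KFree ℓ (f , _ , clique) = contradiction too-many (<⇒≱ (n<1+n (s * 2)))
      where
      part : Fin (suc (s * 2)) → Fin s
      part i = proj₁ (ℓ (f i))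
      class : Fin s → Fin (suc (s * 2)) → Bool
      class c i = ⌊ part i Fin.≟ c ⌋
      class≤2 : ∀ c → count (class c) ≤ 2
      class≤2 c = ≮⇒≥ λ 3≤ → triangle 3≤ (enum (class c))
        where
        triangle : 3 ≤ count (class c) → (Σ (Fin (count (class c)) → Fin (suc (s * 2))) λ g → Injective _≡_ _≡_ g × (∀ i → class c (g i) ≡ true)) → ⊥
        triangle 3≤ (g , inj , ok) = triangle-free (adjacent {zero} {suc zero} λ ()) (adjacent {suc zero} {suc (suc zero)} λ ()) (adjacent {zero} {suc (suc zero)} λ ())
          where
          pt : Fin 3 → Fin (suc (s * 2))
          pt a = g (inject≤ a 3≤)
          at : ∀ a → part (pt a) ≡ c
          at a = ⌊⌋-sound (part (pt a) Fin.≟ c) (ok (inject≤ a 3≤))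
          adjacent : ∀ {a b} → a ≢ b → Adj (proj₂ (ℓ (f (pt a)))) (proj₂ (ℓ (f (pt b))))
          adjacent {a} {b} a≢b = ⌊⌋-sound (Adj? _ _) (trans
            (sym (joined-inside (trans (at a) (sym (at b)))))
            (clique (pt a) (pt b) λ e → a≢b (Fin.inject≤-injective 3≤ 3≤ a b (inj e))))
      too-many : suc (s * 2) ≤ s * 2
      too-many = begin
        suc (s * 2)                                   ≡⟨ sym (trans (sum-const (suc (s * 2)) 1) (*-identityʳ _)) ⟩
        sumFin (suc (s * 2)) (λ _ → 1)                ≤⟨ sum-mono (suc (s * 2)) own ⟩
        sumFin (suc (s * 2)) (λ i → sumFin s (λ c → ⟦ class c i ⟧)) ≡⟨ sum-swap (suc (s * 2)) s (λ i c → ⟦ class c i ⟧) ⟩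
        sumFin s (λ c → count (class c))              ≤⟨ sum-mono s class≤2 ⟩
        sumFin s (λ _ → 2)                            ≡⟨ sum-const s 2 ⟩
        s * 2                                         ∎
        where
        open ≤-Reasoning
        own : ∀ i → 1 ≤ sumFin s (λ c → ⟦ class c i ⟧)
        own i = ≤-trans (≤-reflexive (cong ⟦_⟧ (sym (⌊⌋-true (part i Fin.≟ part i) refl)))) (term≤sum s (λ c → ⟦ class c i ⟧) (part i))

    -- The empty trace puts a shattered set inside one part, where the vertices of the
    -- other parts only realise the full trace.
    join-VCdim : ∀ {n} (ℓ : Fin n → Fin s × V) → VCdim≤ 3 (joinGraph ℓ)
    join-VCdim {n} ℓ k f _ shattered = ≮⇒≥ λ 4≤k → impossible (m≤n⇒∃[o]m+o≡n 4≤k)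
      where
      impossible : (∃ λ r → 4 + r ≡ k) → ⊥
      impossible (r , refl) = no-shattering (λ x → proj₂ (ℓ (g x))) λ S i j _ Sj →
        let v , eq = realise S
            v∈     = trans (proj₁ (joined-false {ℓ v} {ℓ (g j)} (trans (eq j) Sj))) (sym (same j))
            at     = λ x → trans (sym (joined-inside {v = proj₂ (ℓ v)} {w = proj₂ (ℓ (g x))} (trans v∈ (same x)))) (eq x)
        in nbr (proj₂ (ℓ v)) , λ x → (λ Sx → ⌊⌋-sound (Adj? _ _) (trans (at x) Sx))
                                   , λ Sx a → contradiction (trans (sym (⌊⌋-true (Adj? _ _) a)) (trans (at x) Sx)) λ ()
        where
        g : Fin 4 → Fin n
        g x = f (x ↑ˡ r)
        realise : ∀ (S : Fin 4 → Bool) → ∃ λ v → ∀ x → joined (ℓ v) (ℓ (g x)) ≡ S x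
        realise S with v , eq ← shattered (tabulate S ++ᵛ replicate r false) =
          v , λ x → trans (eq (x ↑ˡ r)) (trans (Vec.lookup-++ˡ (tabulate S) _ x) (Vec.lookup∘tabulate S x))
        outside : ∃ λ v → ∀ x → joined (ℓ v) (ℓ (g x)) ≡ false
        outside = realise (λ _ → false)
        same : ∀ x → proj₁ (ℓ (proj₁ outside)) ≡ proj₁ (ℓ (g x))
        same x = proj₁ (joined-false (proj₂ outside x))

    -- Different parts are completely joined, so a nonempty independent set stays in one part. Its
    -- labels form an independent set `I` of the Burling graph, and counting all twins of `I`
    -- reduces the bound to a weight.
    independent-labels : ∀ {n} (ℓ : Fin n → Fin s × V) k → HasIndependentSet (suc k) (joinGraph ℓ) →
      ∃ λ c → ∃ λ I → (∀ u v → I u ≡ true → I v ≡ true → ¬ Adj u v) ×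
        suc k ≤ count (λ x → ⌊ proj₁ (ℓ x) Fin.≟ c ⌋ ∧ I (proj₂ (ℓ x)))
    independent-labels ℓ k (f , inj , indep) = c , I , stable′ , injective⇒≤count _ f inj inside
      where
      c : Fin s
      c = proj₁ (ℓ (f zero))
      used? : ∀ v → Dec (∃ λ i → proj₂ (ℓ (f i)) ≡ v)
      used? v = Fin.any? λ i → proj₂ (ℓ (f i)) ≟V v
      I : V → Bool
      I v = ⌊ used? v ⌋
      stable′ : ∀ u v → I u ≡ true → I v ≡ true → ¬ Adj u v
      stable′ u v Iu Iv with i , refl ← ⌊⌋-sound (used? u) Iu | j , refl ← ⌊⌋-sound (used? v) Iv =
        proj₂ (joined-false {ℓ (f i)} {ℓ (f j)} (indep i j))
      inside : ∀ i → ⌊ proj₁ (ℓ (f i)) Fin.≟ c ⌋ ∧ I (proj₂ (ℓ (f i))) ≡ true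
      inside i = cong₂ _∧_ (⌊⌋-true (_ Fin.≟ c) (proj₁ (joined-false {ℓ (f i)} {ℓ (f zero)} (indep i zero))))
                           (⌊⌋-true (used? _) (i , refl))

  -- With `p = 2 + t`, the excluded clique has `2 * p - 1` vertices and the join has `p - 1` parts.
  ExtremalGraph : ℕ → ℕ → ℕ → ∀ {n} → Graph n → Set
  ExtremalGraph t c e {n} G = KFree (suc (suc t * 2)) G × VCdim≤ 3 G × IndependenceBound c G ×
    e * t * (n * n) ≤ e * (1 + t) * edges G (λ _ → true) + n * n

  -- After `4 * c` Burling steps the weight is `1 + 2 * c` times the number of probes. The factor 2
  -- beyond `c` absorbs the incomplete period, since `suc q` periods have length at most `2 * n`.
  independence-arithmetic : ∀ q M c W m n k → W ≡ (1 + 2 * c) * M → W ≤ m → m ≤ n → q * m ≤ n →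
    k ≤ suc q * M → k * c ≤ n
  independence-arithmetic q M c W m n k W≡ W≤m m≤n qm≤n k≤ = *-cancelˡ-≤ 2 (begin
    2 * (k * c)            ≤⟨ *-monoʳ-≤ 2 (*-monoˡ-≤ c k≤) ⟩
    2 * (suc q * M * c)    ≡⟨ regroup q M c ⟩
    suc q * (2 * c * M)    ≤⟨ *-monoʳ-≤ (suc q) (≤-trans (*-monoˡ-≤ M (m≤n+m (2 * c) 1)) (≤-reflexive (sym W≡))) ⟩
    W + q * W              ≤⟨ +-mono-≤ W≤m (*-monoʳ-≤ q W≤m) ⟩
    m + q * m              ≤⟨ +-mono-≤ m≤n qm≤n ⟩
    n + n                  ≡⟨ cong (n +_) (sym (+-identityʳ n)) ⟩
    2 * n                  ∎)
    where
    open ≤-Reasoning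
    regroup : ∀ q M c → 2 * (suc q * M * c) ≡ suc q * (2 * c * M)
    regroup = solve-∀

  -- Each vertex is joined to at least `q * (t * W)` vertices of the other parts. The last period is
  -- lost in this count, and `n` is large enough for that loss to fit into the error.
  density-arithmetic : ∀ e t n W q E → n ≤ suc q * (suc t * W) → n * (q * (t * W)) ≤ E → e * (t * (suc t * W)) ≤ n →
    e * t * (n * n) ≤ e * (1 + t) * E + n * n
  density-arithmetic e t n W q E n≤ E≥ small = begin
    e * t * (n * n)                                            ≤⟨ *-monoʳ-≤ (e * t) (*-monoʳ-≤ n n≤) ⟩
    e * t * (n * (suc q * (suc t * W)))                        ≡⟨ expand e t n W q ⟩
    e * (1 + t) * (n * (q * (t * W))) + e * (t * (suc t * W)) * n ≤⟨ +-mono-≤ (*-monoʳ-≤ (e * (1 + t)) E≥) (*-monoˡ-≤ n small) ⟩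
    e * (1 + t) * E + n * n                                    ∎
    where
    open ≤-Reasoning
    expand : ∀ e t n W q → e * t * (n * (suc q * (suc t * W))) ≡
      e * (1 + t) * (n * (q * (t * W))) + e * (t * (suc t * W)) * n
    expand = solve-∀

  blow-up : ∀ t c e → ProbeGraph (4 * c) → ∃ λ N → ∀ n → N ≤ n → ∃ λ (G : Graph n) → ExtremalGraph t c e G
  -- The first summand ensures one full period, as the independence bound needs; the second absorbs
  -- the rounding in the density.
  blow-up t c e B = m + e * (t * m) , λ n N≤n →
    G n , join-KFree (ℓ n) , join-VCdim (ℓ n) , independence n (≤-trans (m≤m+n m _) N≤n) , dense n (≤-trans (m≤n+m _ m) N≤n)
    where
    s : ℕ
    s = suc t
    open ProbeGraph B
    open Join {s = s} B
    M W m : ℕ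
    M = length probes
    W = length vertices
    m = s * W
    W≡ : W ≡ (1 + 2 * c) * M
    W≡ = *-cancelˡ-≡ W _ 2 (trans ratio (halve c M))
      where
      halve : ∀ c M → (2 + 4 * c) * M ≡ 2 * ((1 + 2 * c) * M)
      halve = solve-∀
    W>0 : 0 < W
    W>0 = subst (0 <_) (sym W≡) (≤-trans probes>0 (m≤m+n M _))
    instance
      m≢0 : NonZero m
      m≢0 = >-nonZero (≤-trans W>0 (m≤m+n W _))
    labelOf : Fin m → Fin s × V
    labelOf r = proj₁ (remQuot {s} W r) , lookupL vertices (proj₂ (remQuot {s} W r))
    ℓ : ∀ n → Fin n → Fin s × V
    ℓ n x = labelOf (toℕ x mod m)
    G : ∀ n → Graph n
    G n = joinGraph (ℓ n)

    independence : ∀ n → m ≤ n → IndependenceBound c (G n)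
    independence n m≤n zero    _ = z≤n
    independence n m≤n (suc k) S = bound (independent-labels (ℓ n) k S)
      where
      open ≤-Reasoning
      bound : (∃ λ c₀ → ∃ λ I → (∀ u v → I u ≡ true → I v ≡ true → ¬ Adj u v) ×
        suc k ≤ count (λ x → ⌊ proj₁ (ℓ n x) Fin.≟ c₀ ⌋ ∧ I (proj₂ (ℓ n x)))) → suc k * c ≤ n
      bound (c₀ , I , indep , le) =
        independence-arithmetic (n / m) M c W m n (suc k) W≡ (m≤m+n W _) m≤n (proj₁ (/-bounds n m))
          (≤-trans le (≤-trans (sum-residue≤ m weight n) (*-monoʳ-≤ (suc (n / m)) weights≤)))
        where
        weight : Fin m → ℕ
        weight r = ⟦ ⌊ proj₁ (labelOf r) Fin.≟ c₀ ⌋ ∧ I (proj₂ (labelOf r)) ⟧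
        row : ∀ b → count {s} (λ i → ⌊ i Fin.≟ c₀ ⌋ ∧ b) ≤ ⟦ b ⟧
        row true  = ≤-trans (sum-mono s λ i → ≤-reflexive (cong ⟦_⟧ (Bool.∧-identityʳ ⌊ i Fin.≟ c₀ ⌋))) (count-≡ c₀)
        row false = ≤-reflexive (trans (sum-cong s λ i → cong ⟦_⟧ (Bool.∧-zeroʳ ⌊ i Fin.≟ c₀ ⌋)) (trans (sum-const s 0) (*-zeroʳ s)))
        weights≤ : sumFin m weight ≤ M
        weights≤ = begin
          sumFin m weight
            ≡⟨ sum-remQuot s W (λ (i , w) → ⟦ ⌊ i Fin.≟ c₀ ⌋ ∧ I (lookupL vertices w) ⟧) ⟩
          sumFin s (λ i → sumFin W (λ w → ⟦ ⌊ i Fin.≟ c₀ ⌋ ∧ I (lookupL vertices w) ⟧))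
            ≡⟨ sum-swap s W (λ i w → ⟦ ⌊ i Fin.≟ c₀ ⌋ ∧ I (lookupL vertices w) ⟧) ⟩
          sumFin W (λ w → count {s} (λ i → ⌊ i Fin.≟ c₀ ⌋ ∧ I (lookupL vertices w)))
            ≤⟨ sum-mono W (λ w → row (I (lookupL vertices w))) ⟩
          sumFin W (λ w → ⟦ I (lookupL vertices w) ⟧)
            ≡⟨ sum-lookup (λ v → ⟦ I v ⟧) vertices ⟩
          sumL (λ v → ⟦ I v ⟧) vertices
            ≤⟨ weight≤hits I indep ⟩
          sumL (λ p → ⟦ hit I p ⟧) probes
            ≤⟨ sumL-mono probes (λ p → ⟦⟧≤1 (hit I p)) ⟩
          sumL (λ _ → 1) probes
            ≡⟨ sym (length≡sumL probes) ⟩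
          M ∎

    dense : ∀ n → e * (t * m) ≤ n → e * t * (n * n) ≤ e * (1 + t) * edges (G n) (λ _ → true) + n * n
    dense n N≤n = density-arithmetic e t n W (n / m) (edges (G n) (λ _ → true)) (proj₂ (/-bounds n m)) edges≥ N≤n
      where
      open ≤-Reasoning
      q : ℕ
      q = n / m
      other : Fin s → Fin m → ℕ
      other c₀ r = ⟦ not ⌊ proj₁ (labelOf r) Fin.≟ c₀ ⌋ ⟧
      others≥ : ∀ c₀ → t * W ≤ sumFin m (other c₀)
      others≥ c₀ = begin
        t * W                                                       ≤⟨ *-monoˡ-≤ W (count-≢ c₀) ⟩
        count {s} (λ i → not ⌊ i Fin.≟ c₀ ⌋) * W                    ≡⟨ *-comm _ W ⟩
        W * count {s} (λ i → not ⌊ i Fin.≟ c₀ ⌋)                    ≡⟨ sym (sum-*ˡ s W (λ i → ⟦ not ⌊ i Fin.≟ c₀ ⌋ ⟧)) ⟩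
        sumFin s (λ i → W * ⟦ not ⌊ i Fin.≟ c₀ ⌋ ⟧)                 ≡⟨ sum-cong s (λ i → sym (sum-const W ⟦ not ⌊ i Fin.≟ c₀ ⌋ ⟧)) ⟩
        sumFin s (λ i → sumFin W (λ w → ⟦ not ⌊ i Fin.≟ c₀ ⌋ ⟧))    ≡⟨ sym (sum-remQuot s W (λ (i , w) → ⟦ not ⌊ i Fin.≟ c₀ ⌋ ⟧)) ⟩
        sumFin m (other c₀)                                         ∎
      across : ∀ a b → ⟦ not ⌊ proj₁ b Fin.≟ proj₁ a ⌋ ⟧ ≤ ⟦ joined a b ⟧
      across (i , v) (j , w) with i Fin.≟ j
      ... | yes refl = ≤-trans (≤-reflexive (cong (λ d → ⟦ not d ⟧) (⌊⌋-true (i Fin.≟ i) refl))) z≤n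
      ... | no _     = ⟦⟧≤1 _
      edges≥ : n * (q * (t * W)) ≤ edges (G n) (λ _ → true)
      edges≥ = ≤-trans (≤-reflexive (sym (sum-const n _))) (sum-mono n λ x → begin
        q * (t * W)                                              ≤⟨ *-monoʳ-≤ q (others≥ (proj₁ (ℓ n x))) ⟩
        q * sumFin m (other (proj₁ (ℓ n x)))                     ≤⟨ sum-residue≥ m (other (proj₁ (ℓ n x))) n ⟩
        sumFin n (λ y → other (proj₁ (ℓ n x)) (toℕ y mod m)) ≤⟨ sum-mono n (λ y → across (ℓ n x) (ℓ n y)) ⟩
        count (λ y → joined (ℓ n x) (ℓ n y))                     ∎)

  extremal-graph : ∀ t c e → ∃ λ N → ∀ n → N ≤ n → ∃ λ (G : Graph n) → ExtremalGraph t c e G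
  extremal-graph t c e = blow-up t c e (burling (4 * c))

open Combinatorics
open import Data.Nat using (ℕ; zero; suc; _≤_; _∸_; z≤n; s≤s; _<ᵇ_)
import Data.Nat
import Data.Nat as ℕ
import Data.Nat.Properties as ℕ
open import Data.Nat.Tactic.RingSolver using (solve-∀)
import Data.Integer as ℤ
import Data.Integer.Properties as ℤ
open import Data.Rational using (ℚ; 0ℚ; 1ℚ; ½; _<_; _+_; _-_; _*_; -_; toℚᵘ; mkℚ; Positive; NonNegative; *<*) renaming (_/_ to _/ℚ_)
import Data.Rational
import Data.Rational as ℚ
import Data.Rational.Properties as ℚ
open import Data.Rational.Solver using (module +-*-Solver)
import Data.Rational.Unnormalised as ℚᵘ
import Data.Rational.Unnormalised.Properties as ℚᵘ

-- Edge counts and clique sizes.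

<ᵇ-total : ∀ a b → a ≢ b → ⟦ a <ᵇ b ⟧ ℕ.+ ⟦ b <ᵇ a ⟧ ≡ 1
<ᵇ-total zero    zero    ne = contradiction refl ne
<ᵇ-total zero    (suc b) ne = refl
<ᵇ-total (suc a) zero    ne = refl
<ᵇ-total (suc a) (suc b) ne = <ᵇ-total a b (ne ∘ cong suc)

edges≡2*edgeCount : ∀ {n} (G : Graph n) → edges G (λ _ → true) ≡ 2 ℕ.* edgeCount G
edges≡2*edgeCount {n} G = begin
  edges G (λ _ → true)
    ≡⟨ sum-cong n (λ i → trans (sum-cong n (pointwise i)) (sum-+ n _ _)) ⟩
  sumFin n (λ i → sumFin n (λ j → ⟦ adj G i j ∧ (toℕ i <ᵇ toℕ j) ⟧) ℕ.+ sumFin n (λ j → ⟦ adj G j i ∧ (toℕ j <ᵇ toℕ i) ⟧))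
    ≡⟨ sum-+ n _ _ ⟩
  edgeCount G ℕ.+ sumFin n (λ i → sumFin n (λ j → ⟦ adj G j i ∧ (toℕ j <ᵇ toℕ i) ⟧))
    ≡⟨ cong (edgeCount G ℕ.+_) (sum-swap n n _) ⟩
  edgeCount G ℕ.+ edgeCount G
    ≡⟨ cong (edgeCount G ℕ.+_) (sym (ℕ.+-identityʳ _)) ⟩
  2 ℕ.* edgeCount G ∎
  where
  open ≡-Reasoning
  pointwise : ∀ i j → ⟦ adj G i j ⟧ ≡ ⟦ adj G i j ∧ (toℕ i <ᵇ toℕ j) ⟧ ℕ.+ ⟦ adj G j i ∧ (toℕ j <ᵇ toℕ i) ⟧
  pointwise i j rewrite adj-sym G j i with adj G i j in eq
  ... | false = refl
  ... | true  = sym (<ᵇ-total (toℕ i) (toℕ j) λ e → contradiction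
    (trans (sym eq) (trans (cong (adj G i) (sym (Fin.toℕ-injective e))) (irrefl G i))) λ ())

cliqueSize≡ : ∀ t → cliqueSize t ≡ 2 ℕ.* (2 ℕ.+ t)
cliqueSize≡ zero    = refl
cliqueSize≡ (suc t) = trans (cong (λ c → suc (suc c)) (cliqueSize≡ t)) (step t)
  where
  step : ∀ t → suc (suc (2 ℕ.* (2 ℕ.+ t))) ≡ 2 ℕ.* (3 ℕ.+ t)
  step = solve-∀

KFree-weaken : ∀ {n q r} (G : Graph n) → q ≤ r → KFree q G → KFree r G
KFree-weaken G q≤r free (f , inj , clique) =
  free (f ∘ (λ i → inject≤ i q≤r) , Fin.inject≤-injective q≤r q≤r _ _ ∘ inj , λ i j ne → clique _ _ (ne ∘ Fin.inject≤-injective q≤r q≤r i j))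

-- Adjacency is irreflexive, so pairwise adjacency already makes the enumeration of a clique
-- injective.
KFree⇒¬CliqueIn : ∀ {n q} (G : Graph n) → KFree q G → ¬ CliqueIn G (λ _ → true) q
KFree⇒¬CliqueIn G free (f , _ , clique) = free (f , inj , clique)
  where
  inj : ∀ {i j} → f i ≡ f j → i ≡ j
  inj {i} {j} e = decidable-stable (i Fin.≟ j) λ ne →
    contradiction (trans (sym (clique i j ne)) (trans (cong (adj G (f i)) (sym e)) (irrefl G (f i)))) λ ()

-- From integer to rational inequalities.

toℚᵘ-ℕ→ℚ : ∀ m → toℚᵘ (ℕ→ℚ m) ℚᵘ.≃ ℚᵘ.mkℚᵘ (ℤ.+ m) 0
toℚᵘ-ℕ→ℚ m = ℚ.toℚᵘ-fromℚᵘ (ℚᵘ.mkℚᵘ (ℤ.+ m) 0)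

ℕ→ℚ-mono : ∀ {m n} → m ≤ n → ℕ→ℚ m ℚ.≤ ℕ→ℚ n
ℕ→ℚ-mono {m} {n} m≤n = ℚ.toℚᵘ-cancel-≤ (ℚᵘ.≤-respˡ-≃ (ℚᵘ.≃-sym (toℚᵘ-ℕ→ℚ m)) (ℚᵘ.≤-respʳ-≃ (ℚᵘ.≃-sym (toℚᵘ-ℕ→ℚ n))
  (ℚᵘ.*≤* (ℤ.*-monoʳ-≤-nonNeg (ℤ.+ 1) (ℤ.+≤+ m≤n)))))

ℕ→ℚ-cancel : ∀ {m n} → ℕ→ℚ m ℚ.≤ ℕ→ℚ n → m ≤ n
ℕ→ℚ-cancel {m} {n} le = ℤ.drop‿+≤+ (ℤ.*-cancelʳ-≤-pos (ℤ.+ m) (ℤ.+ n) (ℤ.+ 1) (ℚᵘ.drop-*≤*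
  (ℚᵘ.≤-respˡ-≃ (toℚᵘ-ℕ→ℚ m) (ℚᵘ.≤-respʳ-≃ (toℚᵘ-ℕ→ℚ n) (ℚ.toℚᵘ-mono-≤ le)))))

ℕ→ℚ-* : ∀ m n → ℕ→ℚ (m ℕ.* n) ≡ ℕ→ℚ m * ℕ→ℚ n
ℕ→ℚ-* m n = ℚ.toℚᵘ-injective (ℚᵘ.≃-trans (toℚᵘ-ℕ→ℚ (m ℕ.* n)) (ℚᵘ.≃-sym (ℚᵘ.≃-trans (ℚ.toℚᵘ-homo-* (ℕ→ℚ m) (ℕ→ℚ n))
  (ℚᵘ.≃-trans (ℚᵘ.*-cong (toℚᵘ-ℕ→ℚ m) (toℚᵘ-ℕ→ℚ n)) (ℚᵘ.*≡* (cong (ℤ._* ℤ.+ 1) (sym (ℤ.pos-* m n))))))))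

ℕ→ℚ-+ : ∀ m n → ℕ→ℚ (m ℕ.+ n) ≡ ℕ→ℚ m + ℕ→ℚ n
ℕ→ℚ-+ m n = ℚ.toℚᵘ-injective (ℚᵘ.≃-trans (toℚᵘ-ℕ→ℚ (m ℕ.+ n)) (ℚᵘ.≃-sym (ℚᵘ.≃-trans (ℚ.toℚᵘ-homo-+ (ℕ→ℚ m) (ℕ→ℚ n))
  (ℚᵘ.≃-trans (ℚᵘ.+-cong (toℚᵘ-ℕ→ℚ m) (toℚᵘ-ℕ→ℚ n))
    (ℚᵘ.*≡* (cong (ℤ._* ℤ.+ 1) (trans (cong₂ ℤ._+_ (ℤ.*-identityʳ (ℤ.+ m)) (ℤ.*-identityʳ (ℤ.+ n))) (sym (ℤ.pos-+ m n)))))))))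

unit : ℕ → ℚ
unit k = (ℤ.+ 1) /ℚ suc k

unit-inverse : ∀ k → ℕ→ℚ (suc k) * unit k ≡ 1ℚ
unit-inverse k = ℚ.toℚᵘ-injective (ℚᵘ.≃-trans (ℚ.toℚᵘ-homo-* (ℕ→ℚ (suc k)) (unit k))
  (ℚᵘ.≃-trans (ℚᵘ.*-cong (toℚᵘ-ℕ→ℚ (suc k)) (ℚ.toℚᵘ-fromℚᵘ (ℚᵘ.mkℚᵘ (ℤ.+ 1) k)))
    (ℚᵘ.*≡* (trans (ℤ.*-identityʳ _) (trans (ℤ.*-identityʳ _) (cong (λ d → ℤ.+ suc d) (trans (sym (ℕ.+-identityʳ k)) (sym (ℕ.+-identityʳ _)))))))))

unit>0 : ∀ k → 0ℚ < unit k
unit>0 k = ℚ.positive⁻¹ (unit k) {{ℚ.normalize-pos 1 (suc k)}}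

ℕ→ℚ-pos : ∀ m .{{_ : ℕ.NonZero m}} → Positive (ℕ→ℚ m)
ℕ→ℚ-pos m = ℚ.normalize-pos m 1

ℕ→ℚ-nonNeg : ∀ k → NonNegative (ℕ→ℚ k)
ℕ→ℚ-nonNeg k = ℚ.normalize-nonNeg k 1

-- The denominator of `ε` serves: multiplied by it, `ε` becomes its numerator, a positive integer.
archimedean : ∀ ε → 0ℚ < ε → ∃ λ e → 1ℚ ℚ.≤ ℕ→ℚ (suc e) * ε
archimedean ε@(mkℚ (ℤ.+ suc a) d _) _ = d , ℚ.toℚᵘ-cancel-≤ (ℚᵘ.≤-respʳ-≃
  (ℚᵘ.≃-sym (ℚᵘ.≃-trans (ℚ.toℚᵘ-homo-* (ℕ→ℚ (suc d)) ε) (ℚᵘ.*-congʳ {toℚᵘ ε} (toℚᵘ-ℕ→ℚ (suc d)))))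
  (ℚᵘ.*≤* (ℤ.+≤+ (ℕ.≤-trans (ℕ.≤-reflexive (lhs d)) (ℕ.≤-trans (ℕ.m≤m*n (suc d) (suc a)) (ℕ.≤-reflexive (sym (ℕ.*-identityʳ _))))))))
  where
  lhs : ∀ d → suc (d ℕ.+ 0 ℕ.+ 0) ≡ suc d
  lhs d = cong suc (trans (ℕ.+-identityʳ _) (ℕ.+-identityʳ d))
archimedean (mkℚ (ℤ.+ zero) d _) (*<* (ℤ.+<+ ()))
archimedean (mkℚ (ℤ.-[1+ a ]) d _) (*<* ())

rtConst-spec : ∀ t → ℕ→ℚ (suc t) * ℕ→ℚ 2 * rtConst (2 ℕ.+ t) ≡ ℕ→ℚ t
rtConst-spec t = begin
  ℕ→ℚ (suc t) * ℕ→ℚ 2 * (½ * (1ℚ - unit t))    ≡⟨ solve 2 (λ s u → s :* con (ℕ→ℚ 2) :* (con ½ :* (con 1ℚ :- u)) := s :- s :* u) refl (ℕ→ℚ (suc t)) (unit t) ⟩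
  ℕ→ℚ (suc t) - ℕ→ℚ (suc t) * unit t            ≡⟨ cong (λ x → ℕ→ℚ (suc t) - x) (unit-inverse t) ⟩
  ℕ→ℚ (suc t) - 1ℚ                               ≡⟨ cong (_- 1ℚ) (ℕ→ℚ-+ 1 t) ⟩
  1ℚ + ℕ→ℚ t - 1ℚ                                ≡⟨ solve 1 (λ x → con 1ℚ :+ x :- con 1ℚ := x) refl (ℕ→ℚ t) ⟩
  ℕ→ℚ t                                          ∎
  where
  open ≡-Reasoning
  open +-*-Solver

1≤scale*ε : ∀ e t ε → 1ℚ ℚ.≤ ℕ→ℚ (suc e) * ε → 1ℚ ℚ.≤ ℕ→ℚ (suc e) * ε * (ℕ→ℚ (suc t) * ℕ→ℚ 2)
1≤scale*ε e t ε 1≤A = begin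
  1ℚ                                            ≤⟨ 1≤A ⟩
  A                                             ≡⟨ sym (ℚ.*-identityʳ A) ⟩
  A * 1ℚ                                        ≤⟨ ℚ.*-monoˡ-≤-nonNeg A {{ℚ.nonNegative (ℚ.≤-trans (ℕ→ℚ-mono {0} {1} z≤n) 1≤A)}} 1≤B ⟩
  A * (ℕ→ℚ (suc t) * ℕ→ℚ 2)                     ∎
  where
  open ℚ.≤-Reasoning
  A = ℕ→ℚ (suc e) * ε
  1≤B : 1ℚ ℚ.≤ ℕ→ℚ (suc t) * ℕ→ℚ 2
  1≤B = ℚ.≤-trans (ℕ→ℚ-mono {1} {suc t ℕ.* 2} (s≤s z≤n)) (ℚ.≤-reflexive (ℕ→ℚ-* (suc t) 2))

ℕ→ℚ-square-nonNeg : ∀ n → NonNegative (ℕ→ℚ n * ℕ→ℚ n)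
ℕ→ℚ-square-nonNeg n = subst NonNegative (ℕ→ℚ-* n n) (ℕ→ℚ-nonNeg (n ℕ.* n))

-- The multiplier of `edgeCount` in the integer bounds; the last factor 2 comes from ordered pairs.
scale : ℕ → ℕ → ℚ
scale e t = ℕ→ℚ (suc e) * (ℕ→ℚ (suc t) * ℕ→ℚ 2)

scale-ℕ : ∀ e t → ℕ→ℚ (suc e ℕ.* (suc t ℕ.* 2)) ≡ scale e t
scale-ℕ e t = trans (ℕ→ℚ-* (suc e) (suc t ℕ.* 2)) (cong (ℕ→ℚ (suc e) *_) (ℕ→ℚ-* (suc t) 2))

scale-pos : ∀ e t → Positive (scale e t)
scale-pos e t = subst Positive (scale-ℕ e t) (ℕ→ℚ-pos (suc e ℕ.* (suc t ℕ.* 2)))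

scale-edges : ∀ e t E → ℕ→ℚ (suc e ℕ.* suc t ℕ.* (2 ℕ.* E)) ≡ scale e t * ℕ→ℚ E
scale-edges e t E = trans (cong ℕ→ℚ (reassoc (suc e) (suc t) E)) (trans (ℕ→ℚ-* (suc e ℕ.* (suc t ℕ.* 2)) E) (cong (_* ℕ→ℚ E) (scale-ℕ e t)))
  where
  reassoc : ∀ e s E → e ℕ.* s ℕ.* (2 ℕ.* E) ≡ e ℕ.* (s ℕ.* 2) ℕ.* E
  reassoc = solve-∀

scale-main : ∀ e t n → ℕ→ℚ (suc e ℕ.* t ℕ.* (n ℕ.* n)) ≡ scale e t * (rtConst (2 ℕ.+ t) * (ℕ→ℚ n * ℕ→ℚ n))
scale-main e t n = begin
  ℕ→ℚ (suc e ℕ.* t ℕ.* (n ℕ.* n))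
    ≡⟨ trans (ℕ→ℚ-* (suc e ℕ.* t) (n ℕ.* n)) (cong₂ _*_ (ℕ→ℚ-* (suc e) t) (ℕ→ℚ-* n n)) ⟩
  ℕ→ℚ (suc e) * ℕ→ℚ t * N
    ≡⟨ cong (λ x → ℕ→ℚ (suc e) * x * N) (sym (rtConst-spec t)) ⟩
  ℕ→ℚ (suc e) * (ℕ→ℚ (suc t) * ℕ→ℚ 2 * rtConst (2 ℕ.+ t)) * N
    ≡⟨ solve 4 (λ a b c n → a :* (b :* c) :* n := a :* b :* (c :* n)) refl (ℕ→ℚ (suc e)) (ℕ→ℚ (suc t) * ℕ→ℚ 2) (rtConst (2 ℕ.+ t)) N ⟩
  scale e t * (rtConst (2 ℕ.+ t) * N) ∎
  where
  open ≡-Reasoning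
  open +-*-Solver
  N = ℕ→ℚ n * ℕ→ℚ n

-- The integer error `n * n` becomes at most `ε` times the squared order because `suc e` is at least
-- `1 / ε`.
square≤scaled : ∀ e t ε n → 1ℚ ℚ.≤ ℕ→ℚ (suc e) * ε →
  ℕ→ℚ (n ℕ.* n) ℚ.≤ scale e t * (ε * (ℕ→ℚ n * ℕ→ℚ n))
square≤scaled e t ε n 1≤A = begin
  ℕ→ℚ (n ℕ.* n)                                        ≡⟨ trans (ℕ→ℚ-* n n) (sym (ℚ.*-identityˡ N)) ⟩
  1ℚ * N                                                      ≤⟨ ℚ.*-monoʳ-≤-nonNeg N {{ℕ→ℚ-square-nonNeg n}} (1≤scale*ε e t ε 1≤A) ⟩
  ℕ→ℚ (suc e) * ε * (ℕ→ℚ (suc t) * ℕ→ℚ 2) * N                 ≡⟨ solve 4 (λ a b c n → a :* c :* b :* n := a :* b :* (c :* n)) refl (ℕ→ℚ (suc e)) (ℕ→ℚ (suc t) * ℕ→ℚ 2) ε N ⟩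
  scale e t * (ε * N)                                         ∎
  where
  open ℚ.≤-Reasoning
  open +-*-Solver
  N = ℕ→ℚ n * ℕ→ℚ n

upper-rational : ∀ e t ε n E → 1ℚ ℚ.≤ ℕ→ℚ (suc e) * ε →
  suc e ℕ.* suc t ℕ.* (2 ℕ.* E) ≤ suc e ℕ.* t ℕ.* (n ℕ.* n) ℕ.+ n ℕ.* n →
  ℕ→ℚ E ℚ.≤ (rtConst (2 ℕ.+ t) + ε) * (ℕ→ℚ n * ℕ→ℚ n)
upper-rational e t ε n E 1≤A le = ℚ.*-cancelˡ-≤-pos (scale e t) {{scale-pos e t}} (begin
  scale e t * ℕ→ℚ E                                ≡⟨ sym (scale-edges e t E) ⟩
  ℕ→ℚ (suc e ℕ.* suc t ℕ.* (2 ℕ.* E)) ≤⟨ ℕ→ℚ-mono le ⟩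
  ℕ→ℚ (suc e ℕ.* t ℕ.* (n ℕ.* n) ℕ.+ n ℕ.* n)
    ≡⟨ trans (ℕ→ℚ-+ (suc e ℕ.* t ℕ.* (n ℕ.* n)) _) (cong (_+ ℕ→ℚ (n ℕ.* n)) (scale-main e t n)) ⟩
  scale e t * (c * N) + ℕ→ℚ (n ℕ.* n)       ≤⟨ ℚ.+-monoʳ-≤ (scale e t * (c * N)) (square≤scaled e t ε n 1≤A) ⟩
  scale e t * (c * N) + scale e t * (ε * N)        ≡⟨ solve 4 (λ K c ε N → K :* (c :* N) :+ K :* (ε :* N) := K :* ((c :+ ε) :* N)) refl (scale e t) c ε N ⟩
  scale e t * ((c + ε) * N)                        ∎)
  where
  open ℚ.≤-Reasoning
  open +-*-Solver
  c = rtConst (2 ℕ.+ t)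
  N = ℕ→ℚ n * ℕ→ℚ n

lower-rational : ∀ e t ε n E → 1ℚ ℚ.≤ ℕ→ℚ (suc e) * ε →
  suc e ℕ.* t ℕ.* (n ℕ.* n) ≤ suc e ℕ.* suc t ℕ.* (2 ℕ.* E) ℕ.+ n ℕ.* n →
  (rtConst (2 ℕ.+ t) - ε) * (ℕ→ℚ n * ℕ→ℚ n) ℚ.≤ ℕ→ℚ E
lower-rational e t ε n E 1≤A le = ℚ.*-cancelˡ-≤-pos (scale e t) {{scale-pos e t}} (begin
  scale e t * ((c - ε) * N)                        ≡⟨ solve 4 (λ K c ε N → K :* ((c :- ε) :* N) := K :* (c :* N) :- K :* (ε :* N)) refl (scale e t) c ε N ⟩
  scale e t * (c * N) - S                          ≤⟨ ℚ.+-monoˡ-≤ (- S) main ⟩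
  scale e t * ℕ→ℚ E + S - S                        ≡⟨ solve 2 (λ x S → x :+ S :- S := x) refl (scale e t * ℕ→ℚ E) S ⟩
  scale e t * ℕ→ℚ E                                ∎)
  where
  open ℚ.≤-Reasoning
  open +-*-Solver
  c = rtConst (2 ℕ.+ t)
  N = ℕ→ℚ n * ℕ→ℚ n
  S = scale e t * (ε * N)
  main : scale e t * (c * N) ℚ.≤ scale e t * ℕ→ℚ E + S
  main = begin
    scale e t * (c * N)                            ≡⟨ sym (scale-main e t n) ⟩
    ℕ→ℚ (suc e ℕ.* t ℕ.* (n ℕ.* n)) ≤⟨ ℕ→ℚ-mono le ⟩
    ℕ→ℚ (suc e ℕ.* suc t ℕ.* (2 ℕ.* E) ℕ.+ n ℕ.* n)
      ≡⟨ trans (ℕ→ℚ-+ (suc e ℕ.* suc t ℕ.* (2 ℕ.* E)) _) (cong (_+ ℕ→ℚ (n ℕ.* n)) (scale-edges e t E)) ⟩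
    scale e t * ℕ→ℚ E + ℕ→ℚ (n ℕ.* n)       ≤⟨ ℚ.+-monoʳ-≤ (scale e t * ℕ→ℚ E) (square≤scaled e t ε n 1≤A) ⟩
    scale e t * ℕ→ℚ E + S                          ∎

independence-from-ℚ : ∀ {n} (G : Graph n) γ g → γ ℚ.≤ unit g →
  (∀ k → HasIndependentSet k G → ℕ→ℚ k ℚ.≤ γ * ℕ→ℚ n) → IndependenceBound (suc g) G
independence-from-ℚ {n} G γ g γ≤ ind k I = ℕ→ℚ-cancel (begin
  ℕ→ℚ (k ℕ.* suc g)              ≡⟨ trans (ℕ→ℚ-* k (suc g)) (ℚ.*-comm (ℕ→ℚ k) _) ⟩
  ℕ→ℚ (suc g) * ℕ→ℚ k                   ≤⟨ ℚ.*-monoˡ-≤-nonNeg (ℕ→ℚ (suc g)) {{ℕ→ℚ-nonNeg (suc g)}} (ℚ.≤-trans (ind k I) (ℚ.*-monoʳ-≤-nonNeg (ℕ→ℚ n) {{ℕ→ℚ-nonNeg n}} γ≤)) ⟩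
  ℕ→ℚ (suc g) * (unit g * ℕ→ℚ n)        ≡⟨ sym (ℚ.*-assoc (ℕ→ℚ (suc g)) (unit g) (ℕ→ℚ n)) ⟩
  ℕ→ℚ (suc g) * unit g * ℕ→ℚ n          ≡⟨ trans (cong (_* ℕ→ℚ n) (unit-inverse g)) (ℚ.*-identityˡ (ℕ→ℚ n)) ⟩
  ℕ→ℚ n                                 ∎)
  where open ℚ.≤-Reasoning

independence-to-ℚ : ∀ {n} (G : Graph n) γ c → 1ℚ ℚ.≤ ℕ→ℚ (suc c) * γ → IndependenceBound (suc c) G →
  ∀ k → HasIndependentSet k G → ℕ→ℚ k ℚ.≤ γ * ℕ→ℚ n
independence-to-ℚ {n} G γ c 1≤cγ ind k I = ℚ.*-cancelˡ-≤-pos (ℕ→ℚ (suc c)) {{ℕ→ℚ-pos (suc c)}} (begin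
  ℕ→ℚ (suc c) * ℕ→ℚ k        ≡⟨ trans (ℚ.*-comm (ℕ→ℚ (suc c)) _) (sym (ℕ→ℚ-* k (suc c))) ⟩
  ℕ→ℚ (k ℕ.* suc c)   ≤⟨ ℕ→ℚ-mono (ind k I) ⟩
  ℕ→ℚ n                      ≡⟨ sym (ℚ.*-identityˡ (ℕ→ℚ n)) ⟩
  1ℚ * ℕ→ℚ n                 ≤⟨ ℚ.*-monoʳ-≤-nonNeg (ℕ→ℚ n) {{ℕ→ℚ-nonNeg n}} 1≤cγ ⟩
  ℕ→ℚ (suc c) * γ * ℕ→ℚ n    ≡⟨ ℚ.*-assoc (ℕ→ℚ (suc c)) γ (ℕ→ℚ n) ⟩
  ℕ→ℚ (suc c) * (γ * ℕ→ℚ n)  ∎)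
  where open ℚ.≤-Reasoning

-- The asymptotic bounds.

upper-bound : ∀ d t e ε → 1ℚ ℚ.≤ ℕ→ℚ (suc e) * ε → ∃ λ g → ∀ n → 0 ℕ.< n →
  ∀ (G : Graph n) → KFree (cliqueSize t) G → VCdim≤ d G → IndependenceBound g G →
  ℕ→ℚ (edgeCount G) ℚ.≤ (rtConst (2 ℕ.+ t) + ε) * (ℕ→ℚ n * ℕ→ℚ n)
upper-bound d t e ε 1≤A = proj₁ (turan d t (suc e) (s≤s z≤n)) , λ n n>0 G free vc ind →
  upper-rational e t ε n (edgeCount G) 1≤A (subst₂ (λ E a → suc e ℕ.* suc t ℕ.* E ≤ suc e ℕ.* t ℕ.* (a ℕ.* a) ℕ.+ n ℕ.* n)
    (edges≡2*edgeCount G) (trans (sum-const n 1) (ℕ.*-identityʳ n))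
    (proj₂ (turan d t (suc e) (s≤s z≤n)) G vc n>0 ind (λ _ → true) (KFree⇒¬CliqueIn G free)))

lower-bound : ∀ t e c ε → 1ℚ ℚ.≤ ℕ→ℚ (suc e) * ε → ∃ λ N → ∀ n → N ≤ n →
  ∃ λ (G : Graph n) → KFree (suc (suc t ℕ.* 2)) G × VCdim≤ 3 G × IndependenceBound c G ×
    (rtConst (2 ℕ.+ t) - ε) * (ℕ→ℚ n * ℕ→ℚ n) ℚ.≤ ℕ→ℚ (edgeCount G)
lower-bound t e c ε 1≤A = proj₁ (extremal-graph t c (suc e)) , λ n N≤n → convert n (proj₂ (extremal-graph t c (suc e)) n N≤n)
  where
  convert : ∀ n → ∃ (ExtremalGraph t c (suc e) {n}) → ∃ λ (G : Graph n) → KFree (suc (suc t ℕ.* 2)) G × VCdim≤ 3 G × IndependenceBound c G ×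
    (rtConst (2 ℕ.+ t) - ε) * (ℕ→ℚ n * ℕ→ℚ n) ℚ.≤ ℕ→ℚ (edgeCount G)
  convert n (G , free , vc , ind , dense) = G , free , vc , ind ,
    lower-rational e t ε n (edgeCount G) 1≤A (subst (λ E → suc e ℕ.* t ℕ.* (n ℕ.* n) ≤ suc e ℕ.* suc t ℕ.* E ℕ.+ n ℕ.* n)
      (edges≡2*edgeCount G) dense)

-- The construction excludes the smaller clique and the upper bound allows the larger, so
-- monotonicity of `KFree` settles both values of `q` at once.
clique-sizes : ∀ t q → (q ≡ 2 ℕ.* (2 ℕ.+ t) ∸ 1 ⊎ q ≡ 2 ℕ.* (2 ℕ.+ t)) →
  suc (suc t ℕ.* 2) ≤ q × q ≤ cliqueSize t
clique-sizes t _ (inj₁ refl) = ℕ.≤-reflexive (odd t) , ℕ.≤-trans (ℕ.m∸n≤m (2 ℕ.* (2 ℕ.+ t)) 1) (ℕ.≤-reflexive (sym (cliqueSize≡ t)))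
  where
  odd′ : ∀ t → suc (suc (suc t ℕ.* 2)) ≡ 2 ℕ.* (2 ℕ.+ t)
  odd′ = solve-∀
  odd : ∀ t → suc (suc t ℕ.* 2) ≡ 2 ℕ.* (2 ℕ.+ t) ∸ 1
  odd t = cong (_∸ 1) (odd′ t)
clique-sizes t _ (inj₂ refl) = ℕ.≤-trans (ℕ.n≤1+n _) (ℕ.≤-reflexive (even t)) , ℕ.≤-reflexive (sym (cliqueSize≡ t))
  where
  even : ∀ t → suc (suc (suc t ℕ.* 2)) ≡ 2 ℕ.* (2 ℕ.+ t)
  even = solve-∀

theorem5 : ∀ (d p : ℕ) → 4 ≤ d → 3 ≤ p →
    ∀ (q : ℕ) → (q ≡ (2 Data.Nat.* p) ∸ 1 ⊎ q ≡ 2 Data.Nat.* p) →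
    ∀ (ε : ℚ) → 0ℚ < ε →
    ∃ λ (γ₀ : ℚ) → 0ℚ < γ₀ ×
    (∀ (γ : ℚ) → 0ℚ < γ → γ Data.Rational.≤ γ₀ →
    ∃ λ (N : ℕ) → ∀ (n : ℕ) → N ≤ n →
    ((∀ (G : Graph n) → KFree q G → VCdim≤ d G →
    (∀ k → HasIndependentSet k G → ℕ→ℚ k Data.Rational.≤ γ * ℕ→ℚ n) →
    ℕ→ℚ (edgeCount G) Data.Rational.≤ (rtConst p + ε) * (ℕ→ℚ n * ℕ→ℚ n))
    ×
    (∃ λ (G : Graph n) → KFree q G × VCdim≤ d G ×
    (∀ k → HasIndependentSet k G → ℕ→ℚ k Data.Rational.≤ γ * ℕ→ℚ n) ×
    (rtConst p - ε) * (ℕ→ℚ n * ℕ→ℚ n) Data.Rational.≤ ℕ→ℚ (edgeCount G))))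
-- `γ₀` comes from the upper bound alone and precedes `γ`; the construction is then adapted to each
-- given `γ`.
theorem5 d (suc (suc t)) d≥4 (s≤s (s≤s _)) q q≡ ε ε>0 = unit g , unit>0 g , below
  where
  e = archimedean ε ε>0
  up = upper-bound d t (proj₁ e) ε (proj₂ e)
  g = proj₁ up
  sizes = clique-sizes t q q≡
  below : ∀ γ → 0ℚ < γ → γ ℚ.≤ unit g → ∃ λ N → ∀ n → N ≤ n →
    (∀ (G : Graph n) → KFree q G → VCdim≤ d G →
      (∀ k → HasIndependentSet k G → ℕ→ℚ k ℚ.≤ γ * ℕ→ℚ n) →
      ℕ→ℚ (edgeCount G) ℚ.≤ (rtConst (2 ℕ.+ t) + ε) * (ℕ→ℚ n * ℕ→ℚ n)) ×
    (∃ λ (G : Graph n) → KFree q G × VCdim≤ d G ×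
      (∀ k → HasIndependentSet k G → ℕ→ℚ k ℚ.≤ γ * ℕ→ℚ n) ×
      (rtConst (2 ℕ.+ t) - ε) * (ℕ→ℚ n * ℕ→ℚ n) ℚ.≤ ℕ→ℚ (edgeCount G))
  -- The successor makes `n` positive, as the upper bound requires.
  below γ γ>0 γ≤ = suc (proj₁ low) , λ n N≤n →
    (λ G free vc ind → proj₂ up n (ℕ.≤-trans (s≤s z≤n) N≤n) G (KFree-weaken G (proj₂ sizes) free) vc
      (independence-weaken G (ℕ.n≤1+n g) (independence-from-ℚ G γ g γ≤ ind))) ,
    extremal n (proj₂ low n (ℕ.≤-trans (ℕ.n≤1+n _) N≤n))
    where
    c = archimedean γ γ>0
    low = lower-bound t (proj₁ e) (suc (proj₁ c)) ε (proj₂ e)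
    extremal : ∀ n → (∃ λ (G : Graph n) → KFree (suc (suc t ℕ.* 2)) G × VCdim≤ 3 G × IndependenceBound (suc (proj₁ c)) G ×
      (rtConst (2 ℕ.+ t) - ε) * (ℕ→ℚ n * ℕ→ℚ n) ℚ.≤ ℕ→ℚ (edgeCount G)) →
      ∃ λ (G : Graph n) → KFree q G × VCdim≤ d G ×
        (∀ k → HasIndependentSet k G → ℕ→ℚ k ℚ.≤ γ * ℕ→ℚ n) ×
        (rtConst (2 ℕ.+ t) - ε) * (ℕ→ℚ n * ℕ→ℚ n) ℚ.≤ ℕ→ℚ (edgeCount G)
    extremal n (G , free , vc , ind , dense) = G , KFree-weaken G (proj₁ sizes) free ,
      (λ k f inj sh → ℕ.≤-trans (vc k f inj sh) (ℕ.≤-trans (ℕ.n≤1+n 3) d≥4)) ,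
      independence-to-ℚ G γ (proj₁ c) (proj₂ c) ind , dense
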